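{- Let $D(n)=\max_{1\le i\le n} d(i)$, where $d(i)$ is the number of positive divisors of $i$, and let $\omega(n)=D(n)^{100}$. If $p=p(n)\le n^{ -1/9}\omega(n)^{ -1}$, then asymptotically almost surely (i.e. with probability tending to $1$ as $n\to\infty$) the random set $[n]_p$ is not product-Schur.
   Context: $[n]_p$ is the random subset of $[n]=\{1,\dots,n\}$ containing each integer independently with probability $p$. A set $A\subseteq\mathbb{N}$ is product-Schur if every 2-colouring of $A$ yields $a,b,c\in A$ of the same colour with $ab=c$ ($a=b$ allowed).
   Formalization: The probability p(n) is taken to be a rational number for each n, whereas the English allows any real p(n) with p(n) ≤ n^{ -1/9} ω(n)^{ -1}. -}

module Defs where

open import Data.Nat as ℕ using (ℕ; zero; suc; _⊔_)
open import Data.Nat.Divisibility using (_∣_; _∣?_)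
open import Data.Fin using (Fin; toℕ)
open import Data.Fin.Properties using (any?)
open import Data.Fin.Subset using (Subset; inside; outside; _∈_)
open import Data.Fin.Subset.Properties using (_∈?_; anySubset?)
open import Data.List using (List; []; _∷_; map; filter; length; foldr; _++_)
open import Data.Vec using (Vec; []; _∷_; lookup)
open import Data.Bool using (Bool; _≟_)
open import Data.Product using (Σ; ∃; _×_; _,_)
open import Relation.Nullary using (Dec; yes; no; ¬_; ¬?)
open import Relation.Nullary.Decidable using (_×-dec_; decidable-stable)
open import Relation.Binary.PropositionalEquality using (_≡_)
open import Data.Rational as ℚ using (ℚ; 0ℚ; 1ℚ)
import Data.Integer

range1 : ℕ → List ℕ
range1 zero    = []
range1 (suc n) = range1 n ++ (suc n ∷ [])

d : ℕ → ℕ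
d i = length (filter (_∣? i) (range1 i))

D : ℕ → ℕ
D n = foldr _⊔_ 0 (map d (range1 n))

ω : ℕ → ℕ
ω n = D n ℕ.^ 100

-- Subsets of [n] = {1,…,n}: S : Subset n, where the element (k : Fin n)
-- represents the integer toℕ k + 1.
val : ∀ {n} → Fin n → ℕ
val k = suc (toℕ k)

-- A monochromatic product triple in A ⊆ [n] for colouring col (a 2-colouring
-- of [n], colour = lookup col k; only its values on A matter):
-- a, b, c ∈ A of the same colour with a·b = c (a = b allowed).
MonoTriple : ∀ {n} → Subset n → Subset n → Set
MonoTriple {n} A col =
  ∃ λ (a : Fin n) → ∃ λ (b : Fin n) → ∃ λ (c : Fin n) →
    (a ∈ A) × (b ∈ A) × (c ∈ A) ×
    (lookup col a ≡ lookup col c) × (lookup col b ≡ lookup col c) ×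
    (val a ℕ.* val b ≡ val c)

ProductSchur : ∀ {n} → Subset n → Set
ProductSchur {n} A = (col : Subset n) → MonoTriple A col

monoTriple? : ∀ {n} (A col : Subset n) → Dec (MonoTriple A col)
monoTriple? A col =
  any? λ a → any? λ b → any? λ c →
    (a ∈? A) ×-dec (b ∈? A) ×-dec (c ∈? A) ×-dec
    (lookup col a ≟ lookup col c) ×-dec (lookup col b ≟ lookup col c) ×-dec
    (val a ℕ.* val b ℕ.≟ val c)

productSchur? : ∀ {n} (A : Subset n) → Dec (ProductSchur A)
productSchur? A with anySubset? (λ col → ¬? (monoTriple? A col))
... | yes (col , ¬m) = no λ ps → ¬m (ps col)
... | no ¬ex = yes λ col → decidable-stable (monoTriple? A col) (λ ¬m → ¬ex (col , ¬m))

subsets : (n : ℕ) → List (Subset n)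
subsets zero    = [] ∷ []
subsets (suc n) = map (inside ∷_) (subsets n) ++ map (outside ∷_) (subsets n)

-- probability of the outcome S for [n]_p : p^|S| (1-p)^(n-|S|)
weight : ℚ → ∀ {n} → Subset n → ℚ
weight p []            = 1ℚ
weight p (inside ∷ s)  = p ℚ.* weight p s
weight p (outside ∷ s) = (1ℚ ℚ.- p) ℚ.* weight p s

probNotPS : ℚ → ℕ → ℚ
probNotPS p n = sum′ (subsets n)
  where
  sum′ : List (Subset n) → ℚ
  sum′ []       = 0ℚ
  sum′ (S ∷ Ss) with productSchur? S
  ... | yes _ = sum′ Ss
  ... | no  _ = weight p S ℚ.+ sum′ Ss

_^ℚ_ : ℚ → ℕ → ℚ
x ^ℚ zero  = 1ℚ
x ^ℚ suc k = x ℚ.* (x ^ℚ k)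

ℕ→ℚ : ℕ → ℚ
ℕ→ℚ n = Data.Integer.+ n ℚ./ 1

{-# OPTIONS --safe #-}
-- Colour A recursively: x is red if it is a product of two elements of A but not
-- of two red ones, and blue otherwise. There is no red triple, and a blue triple
-- u v = w comes with a factorisation w = c z into red c, z. Split c and z into
-- irreducible elements of A, at least two each and all blue. These factors,
-- counted with multiplicity, together with w, c, z, u, v are nine divisors of w;
-- if u is one of only four factors, then v is blue and reducible, so v = s t with
-- s, t red, and s, or t, or the longer factorisation w = u c c if s = t = c, makes
-- up for the loss. This fails only if c = z or u = v, and then w is a square with
-- at least five divisors in A.
--
-- Such w are rare. Let m be maximal with m p D ≤ 1; with high probability A has
-- no element ≤ m. If R of the nine divisors are repetitions e₁, …, e_R, then
-- w / (e₁ ⋯ e_R) ≤ n / (m + 1)^R is divisible by every eᵢ and determines w and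
-- the other 8 − R divisors up to D⁸ choices, so the expected number of such
-- configurations is at most n (m + 1)^(-R) D⁸ p^(9 − R) ≤ n p⁹ D^(8 + R). For
-- squares the bound is √n D⁴ p⁵. Everything is O(1 / D), and D(n) → ∞.
module Submission where

open import Defs
open import Data.Nat as ℕ using (ℕ; zero; suc; z≤n; s≤s; _^_; _∸_; _≥_)
import Data.Nat.Properties as ℕ
open import Data.Bool as Bool using (Bool; true; false; if_then_else_)
open import Data.Empty using (⊥-elim)
open import Data.Fin.Subset using (Subset; inside; outside; ∣_∣; ⊥; _∈_)
open import Data.Fin.Subset.Properties using (∣⊥∣≡0)
open import Data.List using (List; []; _∷_; [_]; _++_; length; map; filter; concatMap; foldr; take; drop; applyUpTo; upTo)
open import Data.List.Properties using (length-++; length-map; length-filter; length-applyUpTo; length-take; take++drop≡id)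
open import Data.List.Membership.Propositional using (lose) renaming (_∈_ to _∈ₗ_; _∉_ to _∉ₗ_)
open import Data.List.Membership.Propositional.Properties
open import Data.List.Membership.DecPropositional ℕ._≟_ using () renaming (_∈?_ to _∈ₗ?_)
open import Data.List.Relation.Unary.All as All using (All; []; _∷_)
open import Data.List.Relation.Unary.All.Properties as All using (++⁺; take⁺)
open import Data.List.Relation.Unary.AllPairs using ([]; _∷_)
open import Data.List.Relation.Unary.Any using (here; there)
open import Data.List.Relation.Unary.Unique.Propositional using (Unique)
import Data.List.Relation.Unary.Unique.Propositional.Properties as Unique
open import Data.Nat.DivMod using (m*n/n≡m; m/n*n≤m; m/n≤m; /-monoˡ-≤)
open import Data.Nat.ListAction using (product)
open import Data.Nat.ListAction.Properties using (product-++; ∈⇒∣product)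
import Data.Nat.Solver
open import Data.Product using (∃; ∃₂; _×_; _,_; proj₁; proj₂)
open import Data.Sum using (_⊎_; inj₁; inj₂; [_,_]′)
open import Data.Vec using ([]; _∷_; here; there; lookup; tabulate)
open import Data.Vec.Properties using (lookup∘tabulate)
open import Function using (_∘_; case_of_)
open import Function.Bundles using (mk⇔)
open import Relation.Binary.Definitions using (tri<; tri≈; tri>)
open import Relation.Binary.PropositionalEquality hiding ([_])
open import Relation.Nullary using (¬_; yes; no; Dec; does; ¬?)
open import Relation.Nullary.Decidable using (_×-dec_; does-⇔; map′; decidable-stable)
open import Relation.Unary using (Decidable)

-- Subsets of [n] as sets of positive integers

_⊆ᵇ_ : ∀ {n} → Subset n → Subset n → Bool
[]          ⊆ᵇ []      = true
(true  ∷ T) ⊆ᵇ (s ∷ S) = s Bool.∧ (T ⊆ᵇ S)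
(false ∷ T) ⊆ᵇ (s ∷ S) = T ⊆ᵇ S

-- Positions are shifted by one, as in val: the head of S records whether 1 ∈ S.
member : ∀ {n} → ℕ → Subset n → Bool
member x             []      = false
member zero          (b ∷ S) = false
member (suc zero)    (b ∷ S) = b
member (suc (suc x)) (b ∷ S) = member (suc x) S

_∋_ : ∀ {n} → Subset n → ℕ → Set
S ∋ x = member x S ≡ true

∈⇒∋ : ∀ {n} {S : Subset n} {k} → k ∈ S → S ∋ val k
∈⇒∋ here        = refl
∈⇒∋ (there k∈S) = ∈⇒∋ k∈S

∋⇒≤ : ∀ {n} x (S : Subset n) → S ∋ x → x ℕ.≤ n
∋⇒≤ zero          S       _   = z≤n
∋⇒≤ (suc zero)    (b ∷ S) _   = s≤s z≤n
∋⇒≤ (suc (suc x)) (b ∷ S) S∋x = s≤s (∋⇒≤ (suc x) S S∋x)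

-- The number 0 and numbers above `n` are silently dropped, so that arbitrary lists can be turned
-- into subsets; a list affected by this yields too small a set and is discarded in `members`.
insert : ∀ {n} → ℕ → Subset n → Subset n
insert x             []      = []
insert zero          (b ∷ T) = b ∷ T
insert (suc zero)    (b ∷ T) = inside ∷ T
insert (suc (suc x)) (b ∷ T) = b ∷ insert (suc x) T

insert-⊆ : ∀ {n} x (T S : Subset n) → S ∋ x → T ⊆ᵇ S ≡ true → insert x T ⊆ᵇ S ≡ true
insert-⊆ (suc zero)    (true  ∷ T) (true ∷ S) S∋x T⊆S = T⊆S
insert-⊆ (suc zero)    (false ∷ T) (true ∷ S) S∋x T⊆S = T⊆S
insert-⊆ (suc (suc x)) (true  ∷ T) (true ∷ S) S∋x T⊆S = insert-⊆ (suc x) T S S∋x T⊆S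
insert-⊆ (suc (suc x)) (false ∷ T) (s    ∷ S) S∋x T⊆S = insert-⊆ (suc x) T S S∋x T⊆S

-- `S ∋ x` is what puts `x` in the range 1, ..., `n`, where `insert` really adds an element.
∣insert∣ : ∀ {n} x (T S : Subset n) → S ∋ x → ¬ T ∋ x → ∣ insert x T ∣ ≡ suc ∣ T ∣
∣insert∣ (suc zero)    (true  ∷ T) (s ∷ S) S∋x T∌x = ⊥-elim (T∌x refl)
∣insert∣ (suc zero)    (false ∷ T) (s ∷ S) S∋x T∌x = refl
∣insert∣ (suc (suc x)) (true  ∷ T) (s ∷ S) S∋x T∌x = cong suc (∣insert∣ (suc x) T S S∋x T∌x)
∣insert∣ (suc (suc x)) (false ∷ T) (s ∷ S) S∋x T∌x = ∣insert∣ (suc x) T S S∋x T∌x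

insert-∋⁻ : ∀ {n} x y (T : Subset n) → insert x T ∋ y → y ≡ x ⊎ T ∋ y
insert-∋⁻ zero          y             (b ∷ T) ∋y = inj₂ ∋y
insert-∋⁻ (suc zero)    (suc zero)    (b ∷ T) ∋y = inj₁ refl
insert-∋⁻ (suc zero)    (suc (suc y)) (b ∷ T) ∋y = inj₂ ∋y
insert-∋⁻ (suc (suc x)) (suc zero)    (b ∷ T) ∋y = inj₂ ∋y
insert-∋⁻ (suc (suc x)) (suc (suc y)) (b ∷ T) ∋y with insert-∋⁻ (suc x) (suc y) T ∋y
... | inj₁ y≡x = inj₁ (cong suc y≡x)
... | inj₂ T∋y = inj₂ T∋y

⊥∌ : ∀ n x → ¬ (⊥ {n} ∋ x)
⊥∌ (suc n) (suc (suc x)) ⊥∋x = ⊥∌ n (suc x) ⊥∋x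

⊥⊆ : ∀ {n} (S : Subset n) → ⊥ ⊆ᵇ S ≡ true
⊥⊆ []      = refl
⊥⊆ (s ∷ S) = ⊥⊆ S

fromList : ∀ {n} → List ℕ → Subset n
fromList = foldr insert ⊥

fromList-∋⁻ : ∀ {n} xs {y} → fromList {n} xs ∋ y → y ∈ₗ xs
fromList-∋⁻ {n} []       {y} ∋y = ⊥-elim (⊥∌ n y ∋y)
fromList-∋⁻ {n} (x ∷ xs) {y} ∋y with insert-∋⁻ x y (fromList xs) ∋y
... | inj₁ y≡x = here y≡x
... | inj₂ ∋y′ = there (fromList-∋⁻ xs ∋y′)

fromList-⊆ : ∀ {n} (S : Subset n) {xs} → All (S ∋_) xs → fromList xs ⊆ᵇ S ≡ true
fromList-⊆ S []                            = ⊥⊆ S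
fromList-⊆ S {x ∷ xs} (S∋x ∷ S∋xs) = insert-⊆ x (fromList xs) S S∋x (fromList-⊆ S S∋xs)

∣fromList∣ : ∀ {n} (S : Subset n) {xs} → All (S ∋_) xs → Unique xs → ∣ fromList {n} xs ∣ ≡ length xs
∣fromList∣ {n} S [] [] = ∣⊥∣≡0 n
∣fromList∣ S {x ∷ xs} (S∋x ∷ S∋xs) (x∉xs ∷ xs!) =
  trans (∣insert∣ x (fromList xs) S S∋x (λ ∋x → All.lookup x∉xs (fromList-∋⁻ xs ∋x) refl))
        (cong suc (∣fromList∣ S S∋xs xs!))

module _ where

  open import Data.Nat using (_≤_; _<_; _*_; _+_; _/_; _⊓_; _⊔_; NonZero; >-nonZero)
  open import Data.Nat.Divisibility using (_∣_; _∣?_; m∣m*n; n∣m*n; ∣-trans; ∣⇒≤)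
  open import Data.Nat.Induction using (<-rec)
  open import Data.Nat.Properties hiding (_≟_)

  -- Colouring

  FactorsIn : (ℕ → Set) → ℕ → Set
  FactorsIn P x = ∃₂ λ a b → P a × P b × a * b ≡ x

  factors< : ∀ {a b x} → 1 < a → 1 < b → a * b ≡ x → a < x × b < x
  factors< {a} {b} 1<a 1<b refl =
      subst (_< a * b) (*-identityʳ a) (*-monoʳ-< a {{>-nonZero (<-trans (s≤s z≤n) 1<a)}} 1<b)
    , subst (_< a * b) (*-identityˡ b) (*-monoˡ-< b {{>-nonZero (<-trans (s≤s z≤n) 1<b)}} 1<a)

  -- Both factors exceed 1, hence lie below `x`, and a bounded search decides the question.
  factorsIn? : ∀ {P} → Decidable P → (∀ {x} → P x → 1 < x) → Decidable (FactorsIn P)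
  factorsIn? {P} P? P>1 x = map′
    (λ { (a , _ , b , _ , f) → a , b , f })
    (λ { (a , b , Pa , Pb , ab≡x) →
         let a<x , b<x = factors< (P>1 Pa) (P>1 Pb) ab≡x in a , a<x , b , b<x , Pa , Pb , ab≡x })
    (anyUpTo? (λ a → anyUpTo? (λ b → P? a ×-dec P? b ×-dec a * b ℕ.≟ x) x) x)

  product>1 : ∀ {xs} → All (1 <_) xs → 1 ≤ length xs → 1 < product xs
  product>1 {x ∷ []}     (1<x ∷ [])   _ = subst (1 <_) (sym (*-identityʳ x)) 1<x
  product>1 {x ∷ y ∷ xs} (1<x ∷ 1<xs) _ =
    <-trans 1<x (proj₁ (factors< 1<x (product>1 1<xs (s≤s z≤n)) refl))

  does⇒ : ∀ {P : Set} (P? : Dec P) → does P? ≡ true → P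
  does⇒ (yes p) _ = p

  does⇒¬ : ∀ {P : Set} (P? : Dec P) → does P? ≡ false → ¬ P
  does⇒¬ (no ¬p) _ = ¬p

  -- A single occurrence is taken out, so multiplicities survive; `all` carries any property over to
  -- the remaining factors.
  record Removed (x : ℕ) (xs : List ℕ) : Set₁ where
    constructor removed
    field
      rest    : List ℕ
      product≡ : product xs ≡ x * product rest
      length≡ : length xs ≡ suc (length rest)
      all     : ∀ {P : ℕ → Set} → All P xs → All P rest
      keep    : ∀ {y} → y ∈ₗ xs → y ≢ x → y ∈ₗ rest

  remove : ∀ {x xs} → x ∈ₗ xs → Removed x xs
  remove {xs = x ∷ xs} (here refl) =
    removed xs refl refl (λ { (_ ∷ ps) → ps })
      (λ { (here y≡x) y≢x → ⊥-elim (y≢x y≡x) ; (there y∈) _ → y∈ })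
  remove {x} {y ∷ xs} (there x∈xs) with remove x∈xs
  ... | removed r p l a k =
    removed (y ∷ r)
      (trans (cong (y *_) p) (solve 3 (λ y x q → y :* (x :* q) := x :* (y :* q)) refl y x (product r)))
      (cong suc l) (λ { (q ∷ qs) → q ∷ a qs })
      (λ { (here z≡y) _ → here z≡y ; (there z∈) z≢x → there (k z∈ z≢x) })
    where open Data.Nat.Solver.+-*-Solver

  -- Five divisors are enough for a square: the root leaves at most √n choices of `w`, and `w`
  -- together with `others` contributes five factors `p`.
  record SquareWitness (A : ℕ → Set) (w : ℕ) : Set where
    constructor squareWitness
    field
      root     : ℕ
      root²    : root * root ≡ w
      others   : List ℕ
      four     : length others ≡ 4
      inA      : All A others
      divisors : All (_∣ w) others
      unique   : Unique (w ∷ others)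

  -- `factors` may contain repetitions, but `w` and `others` are distinct and avoid `factors`. So
  -- the only coincidences among the nine divisors are repetitions inside `factors`.
  record ManyWitness (A : ℕ → Set) (w : ℕ) : Set where
    constructor manyWitness
    field
      factors  : List ℕ
      others   : List ℕ
      product≡ : product factors ≡ w
      factorsA : All A factors
      othersA  : All A others
      divisors : All (_∣ w) others
      unique   : Unique (w ∷ others)
      disjoint : All (_∉ₗ factors) (w ∷ others)
      -- Together with w itself: nine divisors, the factors counted with multiplicity.
      eight    : 8 ≤ length factors + length others

  Witness : (ℕ → Set) → ℕ → Set
  Witness A w = SquareWitness A w ⊎ ManyWitness A w

  module Colouring (A : ℕ → Set) (A? : Decidable A) (A>1 : ∀ {x} → A x → 1 < x) where

    Reducible : ℕ → Set
    Reducible = FactorsIn A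

    Irreducible : ℕ → Set
    Irreducible x = A x × ¬ Reducible x

    reducible? : Decidable Reducible
    reducible? = factorsIn? A? A>1

    A-nonZero : ∀ {x} → A x → NonZero x
    A-nonZero Ax = >-nonZero (<-trans (s≤s z≤n) (A>1 Ax))

    Class : (ℕ → Bool) → ℕ → Set
    Class f x = A x × f x ≡ true

    redRule? : (f : ℕ → Bool) → Decidable (λ x → Reducible x × ¬ FactorsIn (Class f) x)
    redRule? f x =
      reducible? x ×-dec ¬? (factorsIn? (λ a → A? a ×-dec f a Bool.≟ true) (A>1 ∘ proj₁) x)

    -- The rule at x only looks at proper divisors of x, so x + 1 rounds suffice.
    redIn : ℕ → ℕ → Bool
    redIn zero    x = false
    redIn (suc k) x = does (redRule? (redIn k) x)

    red : ℕ → Bool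
    red x = redIn (suc x) x

    Red Blue : ℕ → Set
    Red  x = A x × red x ≡ true
    Blue x = A x × red x ≡ false

    FactorsIn-cong : ∀ {f g x} → (∀ {a} → a < x → f a ≡ g a) →
                     FactorsIn (Class f) x → FactorsIn (Class g) x
    FactorsIn-cong eq (a , b , (Aa , fa) , (Ab , fb) , ab≡x) =
      let a<x , b<x = factors< (A>1 Aa) (A>1 Ab) ab≡x
      in a , b , (Aa , trans (sym (eq a<x)) fa) , (Ab , trans (sym (eq b<x)) fb) , ab≡x

    redIn-stable : ∀ {k l x} → x < k → x < l → redIn k x ≡ redIn l x
    redIn-stable {suc k} {suc l} {x} (s≤s x≤k) (s≤s x≤l) =
      does-⇔ (mk⇔ (λ (r , nf) → r , nf ∘ FactorsIn-cong (λ a<x → sym (eq a<x)))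
                  (λ (r , nf) → r , nf ∘ FactorsIn-cong eq))
             (redRule? (redIn k) x) (redRule? (redIn l) x)
      where
      eq : ∀ {a} → a < x → redIn k a ≡ redIn l a
      eq a<x = redIn-stable (<-≤-trans a<x x≤k) (<-≤-trans a<x x≤l)

    red⇒ : ∀ {x} → red x ≡ true → Reducible x × ¬ FactorsIn Red x
    red⇒ {x} rx with does⇒ (redRule? (redIn x) x) rx
    ... | r , nf = r , nf ∘ FactorsIn-cong (λ {a} a<x → redIn-stable {suc a} (n<1+n a) a<x)

    -- Otherwise `x` would satisfy the rule for red. So every blue product brings along a red
    -- factorisation, whose factors are in turn reducible by `red⇒`.
    blue⇒ : ∀ {x} → red x ≡ false → Reducible x → FactorsIn Red x
    blue⇒ {x} bx r =
      FactorsIn-cong (λ {a} a<x → redIn-stable {x} {suc a} a<x (n<1+n a))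
        (decidable-stable (factorsIn? (λ a → A? a ×-dec redIn x a Bool.≟ true) (A>1 ∘ proj₁) x)
          (λ nf → does⇒¬ (redRule? (redIn x) x) bx (r , nf)))

    red≢blue : ∀ {x y} → Red x → Blue y → x ≢ y
    red≢blue (_ , rx) (_ , by) refl with trans (sym rx) by
    ... | ()

    irreducible-blue : ∀ {x} → Irreducible x → Blue x
    irreducible-blue {x} (Ax , ¬r) = Ax , irr (red x) refl
      where
      irr : ∀ b → red x ≡ b → red x ≡ false
      irr true  rx = ⊥-elim (¬r (proj₁ (red⇒ rx)))
      irr false bx = bx

    -- `nonEmpty` is the invariant behind `nonTrivial`: concatenating the factors of two parts gives
    -- at least two entries.
    record Factorisation (x : ℕ) : Set where
      constructor factorisation
      field
        factors     : List ℕ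
        irreducible : All Irreducible factors
        product≡    : product factors ≡ x
        nonEmpty    : 1 ≤ length factors
        nonTrivial  : Reducible x → 2 ≤ length factors

    factorise : ∀ x → A x → Factorisation x
    factorise = <-rec _ go
      where
      go : ∀ x → (∀ {y} → y < x → A y → Factorisation y) → A x → Factorisation x
      go x rec Ax with reducible? x
      ... | no ¬r = factorisation (x ∷ []) ((Ax , ¬r) ∷ []) (*-identityʳ x) (s≤s z≤n) (λ r → ⊥-elim (¬r r))
      ... | yes (a , b , Aa , Ab , refl)
          with factors< (A>1 Aa) (A>1 Ab) refl
      ... | a<x , b<x with rec a<x Aa | rec b<x Ab
      ... | factorisation L iL pL nL _ | factorisation M iM pM nM _ =
          factorisation (L ++ M) (++⁺ iL iM)
            (trans (product-++ L M) (cong₂ _*_ pL pM)) (≤-trans (s≤s z≤n) 2≤) (λ _ → 2≤)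
          where
          2≤ : 2 ≤ length (L ++ M)
          2≤ = subst (2 ≤_) (sym (length-++ L)) (+-mono-≤ nL nM)

    -- Divisors forced by a blue triple

    record Clash (w c z u v : ℕ) : Set where
      constructor clash
      field
        Aw : A w
        Rc : Red c
        Rz : Red z
        Bu : Blue u
        Bv : Blue v
        cz : c * z ≡ w
        uv : u * v ≡ w

      c<w = proj₁ (factors< (A>1 (proj₁ Rc)) (A>1 (proj₁ Rz)) cz)
      z<w = proj₂ (factors< (A>1 (proj₁ Rc)) (A>1 (proj₁ Rz)) cz)
      u<w = proj₁ (factors< (A>1 (proj₁ Bu)) (A>1 (proj₁ Bv)) uv)
      v<w = proj₂ (factors< (A>1 (proj₁ Bu)) (A>1 (proj₁ Bv)) uv)

      c∣w : c ∣ w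
      c∣w = subst (c ∣_) cz (m∣m*n z)
      z∣w : z ∣ w
      z∣w = subst (z ∣_) cz (n∣m*n c)
      u∣w : u ∣ w
      u∣w = subst (u ∣_) uv (m∣m*n v)
      v∣w : v ∣ w
      v∣w = subst (v ∣_) uv (n∣m*n u)

    swap-cz : ∀ {w c z u v} → Clash w c z u v → Clash w z c u v
    swap-cz {c = c} {z} (clash Aw Rc Rz Bu Bv cz uv) = clash Aw Rz Rc Bu Bv (trans (*-comm z c) cz) uv

    swap-uv : ∀ {w c z u v} → Clash w c z u v → Clash w c z v u
    swap-uv {u = u} {v} (clash Aw Rc Rz Bu Bv cz uv) = clash Aw Rc Rz Bv Bu cz (trans (*-comm v u) uv)

    factorRed≢ : ∀ {s t x} → Red s → Red t → s * t ≡ x → A x → s < x × s ∣ x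
    factorRed≢ {s} {t} Rs Rt refl Ax = proj₁ (factors< (A>1 (proj₁ Rs)) (A>1 (proj₁ Rt)) refl) , m∣m*n t

    cancelˡ : ∀ {x y z} → A x → x * y ≡ x * z → y ≡ z
    cancelˡ {x} {y} {z} Ax eq = *-cancelˡ-≡ y z x {{A-nonZero Ax}} eq

    module _ {w c u v : ℕ} (cl : Clash w c c u v) where
      open Clash cl

      -- The five divisors are `w`, `e`, `c`, `u`, `v`; the colours keep `c` apart from `u` and `v`.
      squareOf-c : u ≢ v → ∀ {e} → A e → e ∣ w → e < w → e ≢ c → e ≢ u → e ≢ v → SquareWitness A w
      squareOf-c u≢v Ae e∣w e<w e≢c e≢u e≢v =
        squareWitness c cz (_ ∷ c ∷ u ∷ v ∷ []) refl
          (Ae ∷ proj₁ Rc ∷ proj₁ Bu ∷ proj₁ Bv ∷ [])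
          (e∣w ∷ c∣w ∷ u∣w ∷ v∣w ∷ [])
          ((>⇒≢ e<w ∷ >⇒≢ c<w ∷ >⇒≢ u<w ∷ >⇒≢ v<w ∷ []) ∷ (e≢c ∷ e≢u ∷ e≢v ∷ []) ∷
           (red≢blue Rc Bu ∷ red≢blue Rc Bv ∷ []) ∷ (u≢v ∷ []) ∷ [] ∷ [])

      -- Cancelling `u` in `u v = c c` gives `v = u c`, so the blue `v` is reducible and has a red
      -- factor `s`. It is new: `s = c` would make its cofactor `t` equal to the blue `u`.
      squareOf-c² : c ≡ u * u → u ≢ v → SquareWitness A w
      squareOf-c² c≡u² u≢v with v≡uc
        where
        v≡uc : v ≡ u * c
        v≡uc = cancelˡ (proj₁ Bu) (begin
          u * v         ≡⟨ uv ⟩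
          w             ≡⟨ cz ⟨
          c * c         ≡⟨ cong (_* c) c≡u² ⟩
          u * u * c     ≡⟨ *-assoc u u c ⟩
          u * (u * c)   ∎)
          where open ≡-Reasoning
      ... | v≡uc with blue⇒ (proj₂ Bv) (u , c , proj₁ Bu , proj₁ Rc , sym v≡uc)
      ... | s , t , Rs , Rt , st≡v =
        squareOf-c u≢v (proj₁ Rs) (∣-trans s∣v v∣w) (<-trans s<v v<w) s≢c
                   (red≢blue Rs Bu) (red≢blue Rs Bv)
        where
        s<v = proj₁ (factorRed≢ Rs Rt st≡v (proj₁ Bv))
        s∣v = proj₂ (factorRed≢ Rs Rt st≡v (proj₁ Bv))
        s≢c : s ≢ c
        s≢c refl = red≢blue Rt Bu (cancelˡ (proj₁ Rs) (trans st≡v (trans v≡uc (*-comm u s))))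

    -- The red `c` is reducible, `c = a b`, and a factor other than `u` and `v` is the fifth
    -- divisor. If both factors are among `u` and `v`, they are equal, because `u v = w` is larger
    -- than `c`; then `squareOf-c²` applies.
    witness-c≡z : ∀ {w c u v} → Clash w c c u v → SquareWitness A w
    witness-c≡z {w} {c} {u} {v} cl with proj₁ (red⇒ (proj₂ (Clash.Rc cl)))
    ... | a , b , Aa , Ab , ab≡c = go
      where
      open Clash cl
      -- Otherwise `c c = u u` and `c = u`, against the colours.
      u≢v : u ≢ v
      u≢v refl = red≢blue Rc Bu (square-injective c u (trans cz (sym uv)))
        where
        square-injective : ∀ x y → x * x ≡ y * y → x ≡ y
        square-injective x y eq with <-cmp x y
        ... | tri< x<y _ _ = ⊥-elim (<⇒≢ (*-mono-< x<y x<y) eq)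
        ... | tri≈ _ x≡y _ = x≡y
        ... | tri> _ _ x>y = ⊥-elim (>⇒≢ (*-mono-< x>y x>y) eq)
      a<c = proj₁ (factors< (A>1 Aa) (A>1 Ab) ab≡c)
      b<c = proj₂ (factors< (A>1 Aa) (A>1 Ab) ab≡c)
      a∣w = ∣-trans (subst (a ∣_) ab≡c (m∣m*n b)) c∣w
      b∣w = ∣-trans (subst (b ∣_) ab≡c (n∣m*n a)) c∣w
      c≢w = <⇒≢ c<w
      go : SquareWitness A w
      go with a ℕ.≟ u | a ℕ.≟ v | b ℕ.≟ u | b ℕ.≟ v
      ... | no a≢u   | no a≢v   | _        | _        =
        squareOf-c cl u≢v Aa a∣w (<-trans a<c c<w) (<⇒≢ a<c) a≢u a≢v
      ... | _        | _        | no b≢u   | no b≢v   =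
        squareOf-c cl u≢v Ab b∣w (<-trans b<c c<w) (<⇒≢ b<c) b≢u b≢v
      ... | yes refl | _        | yes refl | _        = squareOf-c² cl (sym ab≡c) u≢v
      ... | yes refl | _        | _        | yes refl = ⊥-elim (c≢w (trans (sym ab≡c) uv))
      ... | _        | yes refl | yes refl | _        = ⊥-elim (c≢w (trans (sym ab≡c) (trans (*-comm a b) uv)))
      ... | _        | yes refl | _        | yes refl = squareOf-c² (swap-uv cl) (sym ab≡c) (u≢v ∘ sym)

    module _ {w c z u : ℕ} (cl : Clash w c z u u) (c<z : c < z) where
      open Clash cl

      squareOf-u : ∀ {e} → A e → e ∣ c → e < c → e ≢ u → SquareWitness A w
      squareOf-u Ae e∣c e<c e≢u =
        squareWitness u uv (_ ∷ c ∷ z ∷ u ∷ []) refl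
          (Ae ∷ proj₁ Rc ∷ proj₁ Rz ∷ proj₁ Bu ∷ [])
          (∣-trans e∣c c∣w ∷ c∣w ∷ z∣w ∷ u∣w ∷ [])
          ((>⇒≢ (<-trans e<c c<w) ∷ >⇒≢ c<w ∷ >⇒≢ z<w ∷ >⇒≢ u<w ∷ []) ∷
           (<⇒≢ e<c ∷ <⇒≢ (<-trans e<c c<z) ∷ e≢u ∷ []) ∷
           (<⇒≢ c<z ∷ red≢blue Rc Bu ∷ []) ∷ (red≢blue Rz Bu ∷ []) ∷ [] ∷ [])

      -- Again the fifth divisor is a proper factor of the reducible `c`, kept apart from `z` by
      -- `c < z`. If both factors of `c` were `u`, then `c = u u = w`.
      witness-u≡v : SquareWitness A w
      witness-u≡v with proj₁ (red⇒ (proj₂ Rc))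
      ... | a , b , Aa , Ab , ab≡c with factors< (A>1 Aa) (A>1 Ab) ab≡c | a ℕ.≟ u | b ℕ.≟ u
      ... | a<c , _   | no a≢u   | _        = squareOf-u Aa (subst (a ∣_) ab≡c (m∣m*n b)) a<c a≢u
      ... | _   , b<c | _        | no b≢u   = squareOf-u Ab (subst (b ∣_) ab≡c (n∣m*n a)) b<c b≢u
      ... | _         | yes refl | yes refl = ⊥-elim (<⇒≢ c<w (trans (sym ab≡c) uv))

    irreducible∌ : ∀ {x M} → All Irreducible M → Reducible x → x ∉ₗ M
    irreducible∌ iM r x∈M = proj₂ (All.lookup iM x∈M) r

    module _ {w c z u v} (cl : Clash w c z u v) (c≢z : c ≢ z) where
      open Clash cl

      private
        rw : Reducible w
        rw = c , z , proj₁ Rc , proj₁ Rz , cz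
        rc : Reducible c
        rc = proj₁ (red⇒ (proj₂ Rc))
        rz : Reducible z
        rz = proj₁ (red⇒ (proj₂ Rz))

      -- `w`, `c` and `z` are reducible and so cannot be among the irreducible factors; this leaves
      -- 4 + 4 divisors besides `w`.
      witness-u∉v∉ : u ≢ v → ∀ {M} → All Irreducible M → product M ≡ w → 4 ≤ length M →
                     u ∉ₗ M → v ∉ₗ M → ManyWitness A w
      witness-u∉v∉ u≢v {M} iM pM 4≤M u∉M v∉M =
        manyWitness M (c ∷ z ∷ u ∷ v ∷ []) pM (All.map proj₁ iM)
          (proj₁ Rc ∷ proj₁ Rz ∷ proj₁ Bu ∷ proj₁ Bv ∷ [])
          (c∣w ∷ z∣w ∷ u∣w ∷ v∣w ∷ [])
          ((>⇒≢ c<w ∷ >⇒≢ z<w ∷ >⇒≢ u<w ∷ >⇒≢ v<w ∷ []) ∷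
           (c≢z ∷ red≢blue Rc Bu ∷ red≢blue Rc Bv ∷ []) ∷
           (red≢blue Rz Bu ∷ red≢blue Rz Bv ∷ []) ∷ (u≢v ∷ []) ∷ [] ∷ [])
          (irreducible∌ iM rw ∷ irreducible∌ iM rc ∷ irreducible∌ iM rz ∷ u∉M ∷ v∉M ∷ [])
          (+-monoˡ-≤ 4 4≤M)

      -- A fifth factor replaces `u`, which may itself occur in `M`.
      witness-v∉ : ∀ {M} → All Irreducible M → product M ≡ w → 5 ≤ length M →
                   v ∉ₗ M → ManyWitness A w
      witness-v∉ {M} iM pM 5≤M v∉M =
        manyWitness M (c ∷ z ∷ v ∷ []) pM (All.map proj₁ iM)
          (proj₁ Rc ∷ proj₁ Rz ∷ proj₁ Bv ∷ [])
          (c∣w ∷ z∣w ∷ v∣w ∷ [])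
          ((>⇒≢ c<w ∷ >⇒≢ z<w ∷ >⇒≢ v<w ∷ []) ∷
           (c≢z ∷ red≢blue Rc Bv ∷ []) ∷ (red≢blue Rz Bv ∷ []) ∷ [] ∷ [])
          (irreducible∌ iM rw ∷ irreducible∌ iM rc ∷ irreducible∌ iM rz ∷ v∉M ∷ [])
          (+-monoˡ-≤ 3 5≤M)

      -- The red `s` takes the place of `u`. Being red, it is reducible and hence outside `M`.
      witness-extra : ∀ {M s} → All Irreducible M → product M ≡ w → 4 ≤ length M → v ∉ₗ M →
                      Red s → s ∣ v → s < v → s ≢ c → s ≢ z → ManyWitness A w
      witness-extra {M} {s} iM pM 4≤M v∉M Rs s∣v s<v s≢c s≢z =
        manyWitness M (s ∷ c ∷ z ∷ v ∷ []) pM (All.map proj₁ iM)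
          (proj₁ Rs ∷ proj₁ Rc ∷ proj₁ Rz ∷ proj₁ Bv ∷ [])
          (∣-trans s∣v v∣w ∷ c∣w ∷ z∣w ∷ v∣w ∷ [])
          ((>⇒≢ (<-trans s<v v<w) ∷ >⇒≢ c<w ∷ >⇒≢ z<w ∷ >⇒≢ v<w ∷ []) ∷
           (s≢c ∷ s≢z ∷ <⇒≢ s<v ∷ []) ∷
           (c≢z ∷ red≢blue Rc Bv ∷ []) ∷ (red≢blue Rz Bv ∷ []) ∷ [] ∷ [])
          (irreducible∌ iM rw ∷ irreducible∌ iM (proj₁ (red⇒ (proj₂ Rs))) ∷
           irreducible∌ iM rc ∷ irreducible∌ iM rz ∷ v∉M ∷ [])
          (+-monoˡ-≤ 4 4≤M)

      -- Here c = u b and v = b z. As v is blue and reducible, v = s t with s and t red,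
      -- and neither is z because b is blue.
      witness-u∈c : ∀ {L M} → All Irreducible L → All Irreducible M →
                    product L ≡ c → product M ≡ z → length L ≡ 2 → 2 ≤ length M →
                    u ∈ₗ L → ManyWitness A w
      witness-u∈c {L} {M} iL iM pL pM ∣L∣ ∣M∣ u∈L with remove u∈L
      -- `L` has two entries, so exactly one, `b`, remains besides `u`.
      ... | removed [] _ len _ _ = ⊥-elim (case trans (sym ∣L∣) len of λ ())
      ... | removed (_ ∷ _ ∷ _) _ len _ _ = ⊥-elim (case trans (sym ∣L∣) len of λ ())
      ... | removed (b ∷ []) p _ all _ with all iL
      ... | ib ∷ [] = go
        where
        c≡ub : c ≡ u * b
        c≡ub = trans (sym pL) (trans p (cong (u *_) (*-identityʳ b)))
        v≡bz : v ≡ b * z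
        v≡bz = cancelˡ (proj₁ Bu) (trans uv (trans (sym cz) (trans (cong (_* z) c≡ub) (*-assoc u b z))))
        rv : Reducible v
        rv = b , z , proj₁ ib , proj₁ Rz , sym v≡bz
        iLM = ++⁺ iL iM
        pLM : product (L ++ M) ≡ w
        pLM = trans (product-++ L M) (trans (cong₂ _*_ pL pM) cz)
        4≤LM : 4 ≤ length (L ++ M)
        4≤LM = subst (4 ≤_) (sym (length-++ L)) (+-mono-≤ (≤-reflexive (sym ∣L∣)) ∣M∣)
        ≢z : ∀ {s t} → Red s → Red t → s * t ≡ v → s ≢ z
        ≢z {s} Rs Rt st≡v refl =
          red≢blue Rt (irreducible-blue ib) (cancelˡ (proj₁ Rs) (trans st≡v (trans v≡bz (*-comm b s))))
        extra : ∀ {s t} → Red s → Red t → s * t ≡ v → s ≢ c → ManyWitness A w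
        extra {s} Rs Rt st≡v s≢c =
          let s<v , s∣v = factorRed≢ Rs Rt st≡v (proj₁ Bv)
          in witness-extra iLM pLM 4≤LM (irreducible∌ iLM rv) Rs s∣v s<v s≢c (≢z Rs Rt st≡v)
        go : ManyWitness A w
        go with blue⇒ (proj₂ Bv) rv
        ... | s , t , Rs , Rt , st≡v with s ℕ.≟ c | t ℕ.≟ c
        ... | no s≢c   | _        = extra Rs Rt st≡v s≢c
        ... | _        | no t≢c   = extra Rt Rs (trans (*-comm t s) st≡v) t≢c
        -- Here `v = c c`, so `w = u c c`, and `u` with two copies of `L` makes five irreducible
        -- factors.
        ... | yes refl | yes refl =
          witness-v∉ iuLL (trans (cong (u *_) (trans (product-++ L L) (trans (cong₂ _*_ pL pL) st≡v))) uv)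
            (s≤s (≤-reflexive (sym (trans (length-++ L) (cong₂ _+_ ∣L∣ ∣L∣)))))
            (irreducible∌ iuLL rv)
          where
          iuLL : All Irreducible (u ∷ L ++ L)
          iuLL = All.lookup iL u∈L ∷ ++⁺ iL iL

      -- Having both in `M` would leave further factors above 1 and make `product M` larger than
      -- `u v = w`. As `u ≢ v`, removing `u` does not remove `v`.
      v∉factors : u ≢ v → ∀ {M} → All Irreducible M → product M ≡ w → 4 ≤ length M → u ∈ₗ M → v ∉ₗ M
      v∉factors u≢v {M} iM pM 4≤M u∈M v∈M with remove u∈M
      ... | removed M₁ p₁ l₁ all₁ keep₁ with remove (keep₁ v∈M (u≢v ∘ sym))
      ... | removed M₂ p₂ l₂ all₂ _ = <⇒≢ uv< (trans uv (trans (sym pM) eq))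
        where
        1≤M₂ : 1 ≤ length M₂
        1≤M₂ = ≤-pred (≤-pred (≤-trans (s≤s (s≤s (s≤s z≤n))) (subst (4 ≤_) (trans l₁ (cong suc l₂)) 4≤M)))
        eq : product M ≡ u * v * product M₂
        eq = trans p₁ (trans (cong (u *_) p₂) (sym (*-assoc u v (product M₂))))
        uv< : u * v < u * v * product M₂
        uv< = proj₁ (factors< (subst (1 <_) (sym uv) (A>1 Aw))
                              (product>1 (All.map (A>1 ∘ proj₁) (all₂ (all₁ iM))) 1≤M₂) refl)

    -- With five factors, only `v` has to be new. With four, `L` and `M` have exactly two each, and
    -- exchanging `c` and `z` puts `u` into the first list if necessary.
    witness-u∈ : ∀ {w c z u v} → Clash w c z u v → c ≢ z → u ≢ v →
                 ∀ {L M} → All Irreducible L → All Irreducible M →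
                 product L ≡ c → product M ≡ z → 2 ≤ length L → 2 ≤ length M →
                 u ∈ₗ (L ++ M) → ManyWitness A w
    witness-u∈ cl c≢z u≢v {L} {M} iL iM pL pM 2≤L 2≤M u∈ with 5 ℕ.≤? length (L ++ M)
    ... | yes 5≤LM = witness-v∉ cl c≢z iLM pLM 5≤LM (v∉factors cl c≢z u≢v iLM pLM (≤-trans (n≤1+n 4) 5≤LM) u∈)
      where
      iLM = ++⁺ iL iM
      pLM = trans (product-++ L M) (trans (cong₂ _*_ pL pM) (Clash.cz cl))
    ... | no 5≰LM with ∈-++⁻ L u∈
    ... | inj₁ u∈L = witness-u∈c cl c≢z iL iM pL pM (≤-antisym L≤2 2≤L) 2≤M u∈L
      where
      L≤2 : length L ≤ 2
      L≤2 = +-cancelʳ-≤ 2 _ 2 (≤-trans (+-monoʳ-≤ (length L) 2≤M) (subst (_≤ 4) (length-++ L) (≤-pred (≰⇒> 5≰LM))))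
    ... | inj₂ u∈M = witness-u∈c (swap-cz cl) (c≢z ∘ sym) iM iL pM pL (≤-antisym M≤2 2≤M) 2≤L u∈M
      where
      M≤2 : length M ≤ 2
      M≤2 = +-cancelˡ-≤ 2 _ 2 (≤-trans (+-monoˡ-≤ (length M) 2≤L) (subst (_≤ 4) (length-++ L) (≤-pred (≰⇒> 5≰LM))))

    witness-generic : ∀ {w c z u v} → Clash w c z u v → c ≢ z → u ≢ v → ManyWitness A w
    witness-generic {w} {c} {z} {u} {v} cl c≢z u≢v
      with factorise c (proj₁ (Clash.Rc cl)) | factorise z (proj₁ (Clash.Rz cl))
    ... | factorisation L iL pL _ nL | factorisation M iM pM _ nM = go
      where
      open Clash cl
      2≤L = nL (proj₁ (red⇒ (proj₂ Rc)))
      2≤M = nM (proj₁ (red⇒ (proj₂ Rz)))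
      go : ManyWitness A w
      go with u ∈ₗ? (L ++ M) | v ∈ₗ? (L ++ M)
      ... | yes u∈ | _      = witness-u∈ cl c≢z u≢v iL iM pL pM 2≤L 2≤M u∈
      ... | _      | yes v∈ = witness-u∈ (swap-uv cl) c≢z (u≢v ∘ sym) iL iM pL pM 2≤L 2≤M v∈
      ... | no u∉  | no v∉  =
        witness-u∉v∉ cl c≢z u≢v (++⁺ iL iM) (trans (product-++ L M) (trans (cong₂ _*_ pL pM) cz))
          (subst (4 ≤_) (sym (length-++ L)) (+-mono-≤ 2≤L 2≤M)) u∉ v∉

    clash⇒witness : ∀ {w c z u v} → Clash w c z u v → Witness A w
    clash⇒witness {c = c} {z} {u} {v} cl with u ℕ.≟ v | <-cmp c z
    ... | _        | tri≈ _ refl _ = inj₁ (witness-c≡z cl)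
    ... | yes refl | tri< c<z _ _  = inj₁ (witness-u≡v cl c<z)
    ... | yes refl | tri> _ _ z<c  = inj₁ (witness-u≡v (swap-cz cl) z<c)
    ... | no u≢v   | tri< _ c≢z _  = inj₂ (witness-generic cl c≢z u≢v)
    ... | no u≢v   | tri> _ c≢z _  = inj₂ (witness-generic cl c≢z u≢v)

    monochromatic⇒witness : ∀ {a b x} → A a → A b → A x → red a ≡ red x → red b ≡ red x → a * b ≡ x → Witness A x
    monochromatic⇒witness {a} {b} {x} Aa Ab Ax ra rb ab≡x with red x in rx
    ... | true  = ⊥-elim (proj₂ (red⇒ rx) (a , b , (Aa , ra) , (Ab , rb) , ab≡x))
    ... | false with blue⇒ rx (a , b , Aa , Ab , ab≡x)
    ... | c , z , Rc , Rz , cz = clash⇒witness (clash Ax Rc Rz (Aa , ra) (Ab , rb) cz ab≡x)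

  -- Enumerating the exceptional configurations

  range1-∈ : ∀ {i} n → 1 ≤ i → i ≤ n → i ∈ₗ range1 n
  range1-∈ zero    1≤i i≤0 = ⊥-elim (<⇒≱ 1≤i i≤0)
  range1-∈ {i} (suc n) 1≤i i≤ with i ℕ.≟ suc n
  ... | yes refl = ∈-++⁺ʳ (range1 n) (here refl)
  ... | no i≢    = ∈-++⁺ˡ (range1-∈ n 1≤i (≤-pred (≤∧≢⇒< i≤ i≢)))

  ∈-range1⇒≤ : ∀ {i} n → i ∈ₗ range1 n → i ≤ n
  ∈-range1⇒≤ (suc n) i∈ with ∈-++⁻ (range1 n) i∈
  ... | inj₁ i∈n         = m≤n⇒m≤1+n (∈-range1⇒≤ n i∈n)
  ... | inj₂ (here refl) = ≤-refl

  length-range1 : ∀ n → length (range1 n) ≡ n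
  length-range1 zero    = refl
  length-range1 (suc n) = trans (length-++ (range1 n)) (trans (+-comm _ 1) (cong suc (length-range1 n)))

  d≤D : ∀ {i n} → i ≤ n → d i ≤ D n
  d≤D {zero}      i≤n = z≤n
  d≤D {suc i} {n} i≤n = max (map d (range1 n)) (∈-map⁺ d (range1-∈ n (s≤s z≤n) i≤n))
    where
    max : ∀ xs {x} → x ∈ₗ xs → x ≤ foldr _⊔_ 0 xs
    max (y ∷ xs) (here refl) = m≤m⊔n y _
    max (y ∷ xs) (there x∈)  = ≤-trans (max xs x∈) (m≤n⊔m y _)

  divisors : ℕ → List ℕ
  divisors i = filter (_∣? i) (range1 i)

  ∈-divisors : ∀ {x i} → 1 ≤ x → 1 ≤ i → x ∣ i → x ∈ₗ divisors i
  ∈-divisors 1≤x 1≤i x∣i =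
    ∈-filter⁺ (_∣? _) (range1-∈ _ 1≤x (∣⇒≤ {{>-nonZero 1≤i}} x∣i)) x∣i

  unique⇒length≤ : ∀ {xs ys} → Unique xs → (∀ {x} → x ∈ₗ xs → x ∈ₗ ys) → length xs ≤ length ys
  unique⇒length≤ {[]}     _            _   = z≤n
  unique⇒length≤ {x ∷ xs} (x∉xs ∷ xs!) sub with remove (sub (here refl))
  ... | removed rest _ len _ keep = subst (suc (length xs) ≤_) (sym len)
    (s≤s (unique⇒length≤ xs! (λ y∈xs → keep (sub (there y∈xs)) (λ y≡x → All.lookup x∉xs y∈xs (sym y≡x)))))

  -- The `k + 1` powers 2^0, ..., 2^k are distinct divisors. This is the source of D(n) → ∞.
  k<d[2^k] : ∀ k → k < d (2 ^ k)
  k<d[2^k] k = subst (_≤ d (2 ^ k)) (length-applyUpTo (2 ^_) (suc k))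
    (unique⇒length≤ (Unique.applyUpTo⁺₁ (2 ^_) (suc k) (λ i<j _ → <⇒≢ (^-monoʳ-< 2 (s≤s (s≤s z≤n)) i<j))) sub)
    where
    sub : ∀ {x} → x ∈ₗ applyUpTo (2 ^_) (suc k) → x ∈ₗ divisors (2 ^ k)
    sub x∈ with ∈-applyUpTo⁻ (2 ^_) x∈
    ... | i , s≤s i≤k , refl = ∈-divisors (m^n>0 2 i) (m^n>0 2 k)
      (subst (2 ^ i ∣_) (trans (sym (^-distribˡ-+-* 2 i (k ∸ i))) (cong (2 ^_) (m+[n∸m]≡n i≤k))) (m∣m*n (2 ^ (k ∸ i))))

  D-unbounded : ∀ k {n} → 2 ^ k ≤ n → k ≤ D n
  D-unbounded k 2^k≤n = ≤-trans (<⇒≤ (k<d[2^k] k)) (d≤D 2^k≤n)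

  module _ {a b} {A : Set a} {B : Set b} where

    length-concatMap≤ : ∀ (f : A → List B) xs {k} → (∀ {x} → x ∈ₗ xs → length (f x) ≤ k) →
                        length (concatMap f xs) ≤ length xs * k
    length-concatMap≤ f []       f≤ = z≤n
    length-concatMap≤ f (x ∷ xs) f≤ = subst (_≤ _) (sym (length-++ (f x)))
      (+-mono-≤ (f≤ (here refl)) (length-concatMap≤ f xs (f≤ ∘ there)))

    ∈-concatMap : ∀ (f : A → List B) {xs x y} → x ∈ₗ xs → y ∈ₗ f x → y ∈ₗ concatMap f xs
    ∈-concatMap f x∈xs y∈fx = ∈-concatMap⁺ f (lose x∈xs y∈fx)

  tuples : ∀ {a} {A : Set a} → ℕ → List A → List (List A)
  tuples zero    xs = [] ∷ []
  tuples (suc k) xs = concatMap (λ x → map (x ∷_) (tuples k xs)) xs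

  length-tuples≤ : ∀ {a} {A : Set a} k (xs : List A) → length (tuples k xs) ≤ length xs ^ k
  length-tuples≤ zero    xs = ≤-refl
  length-tuples≤ (suc k) xs = length-concatMap≤ _ xs
    (λ {x} _ → ≤-trans (≤-reflexive (length-map (x ∷_) (tuples k xs))) (length-tuples≤ k xs))

  ∈-tuples : ∀ {a} {A : Set a} {xs ys : List A} → All (_∈ₗ xs) ys → ys ∈ₗ tuples (length ys) xs
  ∈-tuples []         = here refl
  ∈-tuples (y∈ ∷ ys∈) = ∈-concatMap _ y∈ (∈-map⁺ (_ ∷_) (∈-tuples ys∈))

  -- Empty for w > n, where d w need not be bounded by D n.
  divisorLists : ℕ → ℕ → ℕ → List (List ℕ)
  divisorLists n k w with w ℕ.≤? n
  ... | yes _ = map (w ∷_) (tuples k (divisors w))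
  ... | no  _ = []

  length-divisorLists≤ : ∀ n k w → length (divisorLists n k w) ≤ D n ^ k
  length-divisorLists≤ n k w with w ℕ.≤? n
  ... | no  _   = z≤n
  ... | yes w≤n = ≤-trans (≤-reflexive (length-map (w ∷_) (tuples k (divisors w))))
                  (≤-trans (length-tuples≤ k (divisors w)) (^-monoˡ-≤ k (d≤D w≤n)))

  ∈-divisorLists : ∀ {n w xs} → 1 ≤ w → w ≤ n → All (1 ≤_) xs → All (_∣ w) xs →
                   (w ∷ xs) ∈ₗ divisorLists n (length xs) w
  ∈-divisorLists {n} {w} {xs} 1≤w w≤n 1≤xs xs∣w with w ℕ.≤? n
  ... | no w≰n = ⊥-elim (w≰n w≤n)
  ... | yes _  = ∈-map⁺ (w ∷_) (∈-tuples (All.zipWith (λ (1≤x , x∣w) → ∈-divisors 1≤x 1≤w x∣w) (1≤xs , xs∣w)))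

  smallLists : ℕ → List (List ℕ)
  smallLists m = map [_] (range1 m)

  squareLists : ℕ → ℕ → List (List ℕ)
  squareLists n r = concatMap (λ c → divisorLists n 4 (c * c)) (range1 r)

  -- es are the R repeated factors; all of them divide the quotient v of w by their product.
  manyLists : ℕ → ℕ → ℕ → List (List ℕ)
  manyLists n q R = concatMap (λ v → concatMap (λ es → divisorLists n (8 ∸ R) (v * product es)) (tuples R (divisors v)))
                              (range1 q)

  length-smallLists : ∀ m → length (smallLists m) ≡ m
  length-smallLists m = trans (length-map [_] (range1 m)) (length-range1 m)

  length-squareLists≤ : ∀ n r → length (squareLists n r) ≤ r * D n ^ 4
  length-squareLists≤ n r = ≤-trans
    (length-concatMap≤ (λ c → divisorLists n 4 (c * c)) (range1 r) (λ {c} _ → length-divisorLists≤ n 4 (c * c)))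
    (≤-reflexive (cong (_* D n ^ 4) (length-range1 r)))

  -- For each quotient, `R` entries are chosen among its divisors and `8 ∸ R` among those of `w`.
  -- Both numbers are at most `n`, so each of the eight choices has at most `D n` options.
  length-manyLists≤ : ∀ n q R → q ≤ n → R ≤ 8 → length (manyLists n q R) ≤ q * D n ^ 8
  length-manyLists≤ n q R q≤n R≤8 = ≤-trans
    (length-concatMap≤ lists (range1 q) inner) (≤-reflexive (cong (_* D n ^ 8) (length-range1 q)))
    where
    lists : ℕ → List (List ℕ)
    lists v = concatMap (λ es → divisorLists n (8 ∸ R) (v * product es)) (tuples R (divisors v))
    inner : ∀ {v} → v ∈ₗ range1 q → length (lists v) ≤ D n ^ 8
    inner {v} v∈ = begin
      length (lists v)
        ≤⟨ length-concatMap≤ (λ es → divisorLists n (8 ∸ R) (v * product es)) (tuples R (divisors v))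
             (λ {es} _ → length-divisorLists≤ n (8 ∸ R) (v * product es)) ⟩
      length (tuples R (divisors v)) * D n ^ (8 ∸ R)
        ≤⟨ *-monoˡ-≤ (D n ^ (8 ∸ R)) (≤-trans (length-tuples≤ R (divisors v))
             (^-monoˡ-≤ R (d≤D (≤-trans (∈-range1⇒≤ q v∈) q≤n)))) ⟩
      D n ^ R * D n ^ (8 ∸ R) ≡⟨ ^-distribˡ-+-* (D n) R (8 ∸ R) ⟨
      D n ^ (R + (8 ∸ R))     ≡⟨ cong (D n ^_) (m+[n∸m]≡n R≤8) ⟩
      D n ^ 8                 ∎
      where open ≤-Reasoning

  -- Separating repeated factors

  record Split (M : List ℕ) : Set where
    constructor split′
    field
      distinct repeated : List ℕ
      unique   : Unique distinct
      repeat   : All (_∈ₗ distinct) repeated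
      sub      : All (_∈ₗ M) distinct
      product≡ : product M ≡ product distinct * product repeated
      length≡  : length M ≡ length distinct + length repeated

  -- One copy of each value goes to `distinct`, all others to `repeated`. Every repeated factor thus
  -- still divides the product of `distinct`.
  split : ∀ M → Split M
  split [] = split′ [] [] [] [] [] refl refl
  split (x ∷ M) with split M
  ... | split′ D E D! E∈ D⊆ pr len with x ∈ₗ? D
  ... | yes x∈D = split′ D (x ∷ E) D! (x∈D ∷ E∈) (All.map there D⊆)
    (trans (cong (x *_) pr) (trans (sym (*-assoc x (product D) (product E)))
      (trans (cong (_* product E) (*-comm x (product D))) (*-assoc (product D) x (product E)))))
    (trans (cong suc len) (sym (+-suc (length D) (length E))))
  ... | no x∉D = split′ (x ∷ D) E
    (All.map (λ {y} y∈D x≡y → x∉D (subst (_∈ₗ D) (sym x≡y) y∈D)) (All.tabulate (λ y∈ → y∈)) ∷ D!)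
    (All.map there E∈) (here refl ∷ All.map there D⊆)
    (trans (cong (x *_) pr) (sym (*-assoc x (product D) (product E))))
    (cong suc len)

  product≥^ : ∀ {m xs} → All (m <_) xs → suc m ^ length xs ≤ product xs
  product≥^ []           = ≤-refl
  product≥^ (m<x ∷ m<xs) = *-mono-≤ m<x (product≥^ m<xs)

  length-take≡ : ∀ {a} {A : Set a} k (xs : List A) → k ≤ length xs → length (take k xs) ≡ k
  length-take≡ k xs k≤ = trans (length-take k xs) (m≤n⇒m⊓n≡m k≤)

  isqrt : ∀ n → ∃ λ r → r * r ≤ n × (∀ {x} → x * x ≤ n → x ≤ r)
  isqrt zero = 0 , z≤n , λ { {zero} _ → z≤n }
  isqrt (suc n) with isqrt n
  ... | r , r²≤n , max with suc r * suc r ℕ.≤? suc n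
  ... | yes r+1 = suc r , r+1 , bound
    where
    bound : ∀ {x} → x * x ≤ suc n → x ≤ suc r
    bound {x} x² = ≮⇒≥ λ r+1<x → ≤⇒≯ (max (≤-pred (≤-trans (*-mono-< r+1<x r+1<x) x²))) (n<1+n r)
  ... | no r+1≰ = r , m≤n⇒m≤1+n r²≤n , λ {x} x² → ≮⇒≥ λ r<x → r+1≰ (≤-trans (*-mono-≤ r<x r<x) x²)

  -- Only the lists of the given length and without repetition matter.
  Family : Set
  Family = ℕ × List (List ℕ)

  Covers : ∀ {n} → Family → Subset n → Set
  Covers (k , Ls) S = ∃ λ L → L ∈ₗ Ls × All (S ∋_) L × Unique L × length L ≡ k

  -- If all elements exceed `m`, dividing a number up to `n` by `R` of them leaves at most this.
  quotient : ℕ → ℕ → ℕ → ℕ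
  quotient n m R = (n / (suc m ^ R)) {{m^n≢0 (suc m) R}}

  smallFamily : ℕ → Family
  smallFamily m = 1 , smallLists m

  squareFamily : ℕ → Family
  squareFamily n = 5 , squareLists n (proj₁ (isqrt n))

  -- Nine divisors of which `R` are repetitions leave `9 ∸ R` different elements of the random set.
  manyFamily : ℕ → ℕ → ℕ → Family
  manyFamily n m R = 9 ∸ R , manyLists n (quotient n m R) R

  ≤-quotient : ∀ {n} m R {v} → v * suc m ^ R ≤ n → v ≤ quotient n m R
  ≤-quotient m R {v} le = subst (_≤ _) (m*n/n≡m v (suc m ^ R)) (/-monoˡ-≤ (suc m ^ R) le)
    where instance _ = m^n≢0 (suc m) R

  -- Schur sets contain a listed configuration

  module _ {n m} {S : Subset n} (S>m : ∀ {x} → S ∋ x → m < x) where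

    S≥1 : ∀ {x} → S ∋ x → 1 ≤ x
    S≥1 S∋x = ≤-trans (s≤s z≤n) (S>m S∋x)

    square-covers : ∀ {w} → S ∋ w → SquareWitness (S ∋_) w → Covers (squareFamily n) S
    square-covers {w} S∋w (squareWitness c c² X four X∈ X∣w uniq) =
      w ∷ X , L∈ , S∋w ∷ X∈ , uniq , cong suc four
      where
      w≤n = ∋⇒≤ w S S∋w
      1≤c : 1 ≤ c
      1≤c = n≢0⇒n>0 λ { refl → <⇒≢ (S≥1 S∋w) c² }
      L∈ : w ∷ X ∈ₗ squareLists n (proj₁ (isqrt n))
      L∈ = ∈-concatMap (λ c → divisorLists n 4 (c * c))
        (range1-∈ _ 1≤c (proj₂ (proj₂ (isqrt n)) (subst (_≤ n) (sym c²) w≤n)))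
        (subst (λ x → w ∷ X ∈ₗ divisorLists n 4 x) (sym c²)
          (subst (λ k → w ∷ X ∈ₗ divisorLists n k w) four
            (∈-divisorLists (S≥1 S∋w) w≤n (All.map S≥1 X∈) X∣w)))

    -- Repetitions beyond the eighth are multiplied back into the quotient `v`; of the other
    -- divisors, just as many are kept as the family asks for.
    many-covers : ∀ {w} → S ∋ w → ManyWitness (S ∋_) w → ∃ λ R → R ≤ 8 × Covers (manyFamily n m R) S
    many-covers {w} S∋w (manyWitness M X pM M∈ X∈ X∣w uniq disj 8≤) with split M
    ... | split′ D E D! E⊆D D⊆M pr len =
      R , R≤8 , w ∷ K , L∈ , S∋w ∷ K∈ , K! , trans (cong suc ∣K∣) (sym (+-∸-assoc 1 R≤8))
      where
      -- The cap at 8 leaves room for `w` among the `9 ∸ R` elements.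
      R  = 8 ⊓ length E
      R≤8 : R ≤ 8
      R≤8 = m⊓n≤m 8 (length E)
      E₁ = take 8 E
      E₂ = drop 8 E
      ∣E₁∣ : length E₁ ≡ R
      ∣E₁∣ = length-take 8 E
      K = take (8 ∸ R) (X ++ D)
      -- Either `E` alone supplies eight divisors, or `R` counts all of `E` and the bound `eight` of
      -- the witness applies.
      8≤R+ : 8 ≤ R + length (X ++ D)
      8≤R+ with ≤-total 8 (length E)
      ... | inj₁ 8≤E = subst (λ r → 8 ≤ r + length (X ++ D)) (sym (m≤n⇒m⊓n≡m 8≤E)) (m≤m+n 8 _)
      ... | inj₂ E≤8 = subst (λ r → 8 ≤ r + length (X ++ D)) (sym (m≥n⇒m⊓n≡n E≤8))
        (≤-trans 8≤ (≤-reflexive (begin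
          length M + length X                   ≡⟨ cong (_+ length X) (trans len (+-comm (length D) (length E))) ⟩
          length E + length D + length X        ≡⟨ +-assoc (length E) (length D) (length X) ⟩
          length E + (length D + length X)      ≡⟨ cong (length E +_) (trans (+-comm (length D) (length X)) (sym (length-++ X))) ⟩
          length E + length (X ++ D)            ∎)))
        where open ≡-Reasoning
      ∣K∣ : length K ≡ 8 ∸ R
      ∣K∣ = length-take≡ (8 ∸ R) (X ++ D) (m≤n+o⇒m∸n≤o 8 R 8≤R+)
      K∈ : All (S ∋_) K
      K∈ = take⁺ (8 ∸ R) (++⁺ X∈ (All.map (All.lookup M∈) D⊆M))
      K∣w : All (_∣ w) K
      K∣w = take⁺ (8 ∸ R) (++⁺ X∣w (All.map (λ x∈M → subst (_ ∣_) pM (∈⇒∣product x∈M)) D⊆M))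
      K! : Unique (w ∷ K)
      K! = Unique.take⁺ (suc (8 ∸ R)) (Unique.++⁺ uniq D!
        (λ (y∈wX , y∈D) → All.lookup disj y∈wX (All.lookup D⊆M y∈D)))
      -- One copy of every factor stays in `v`, so all of `E₁` divide it, although `w` has been
      -- divided by their product.
      v = product D * product E₂
      w≡ : v * product E₁ ≡ w
      w≡ = begin
        product D * product E₂ * product E₁   ≡⟨ *-assoc (product D) (product E₂) (product E₁) ⟩
        product D * (product E₂ * product E₁) ≡⟨ cong (product D *_) (*-comm (product E₂) (product E₁)) ⟩
        product D * (product E₁ * product E₂) ≡⟨ cong (product D *_) (product-++ E₁ E₂) ⟨
        product D * product (E₁ ++ E₂)        ≡⟨ cong (λ xs → product D * product xs) (take++drop≡id 8 E) ⟩
        product D * product E                 ≡⟨ pr ⟨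
        product M                             ≡⟨ pM ⟩
        w                                     ∎
        where open ≡-Reasoning
      E₁∈ : All (S ∋_) E₁
      E₁∈ = take⁺ 8 (All.map (λ e∈D → All.lookup M∈ (All.lookup D⊆M e∈D)) E⊆D)
      w≤n = ∋⇒≤ w S S∋w
      1≤v : 1 ≤ v
      1≤v = n≢0⇒n>0 λ v≡0 → <⇒≢ (S≥1 S∋w) (trans (sym (cong (_* product E₁) v≡0)) w≡)
      v≤q : v ≤ quotient n m R
      v≤q = ≤-quotient m R (begin
        v * suc m ^ R             ≡⟨ cong (λ r → v * suc m ^ r) ∣E₁∣ ⟨
        v * suc m ^ length E₁     ≤⟨ *-monoʳ-≤ v (product≥^ (All.map S>m E₁∈)) ⟩
        v * product E₁            ≡⟨ w≡ ⟩
        w                         ≤⟨ w≤n ⟩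
        n                         ∎)
        where open ≤-Reasoning
      E₁∈divisors : All (_∈ₗ divisors v) E₁
      E₁∈divisors = All.zipWith
        (λ (S∋e , e∈D) → ∈-divisors (S≥1 S∋e) 1≤v (∣-trans (∈⇒∣product e∈D) (m∣m*n (product E₂))))
        (E₁∈ , take⁺ 8 E⊆D)
      L∈ : w ∷ K ∈ₗ manyLists n (quotient n m R) R
      L∈ = ∈-concatMap (λ v → concatMap (λ es → divisorLists n (8 ∸ R) (v * product es)) (tuples R (divisors v)))
        (range1-∈ _ 1≤v v≤q)
        (∈-concatMap (λ es → divisorLists n (8 ∸ R) (v * product es))
          (subst (λ r → E₁ ∈ₗ tuples r (divisors v)) ∣E₁∣ (∈-tuples E₁∈divisors))
          (subst (λ x → w ∷ K ∈ₗ divisorLists n (8 ∸ R) x) (sym w≡)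
            (subst (λ k → w ∷ K ∈ₗ divisorLists n k w) ∣K∣
              (∈-divisorLists (S≥1 S∋w) w≤n (All.map S≥1 K∈) K∣w))))

  ∌0 : ∀ {n} (S : Subset n) → ¬ S ∋ 0
  ∌0 []      ()
  ∌0 (b ∷ S) ()

  small-covers : ∀ {n} {S : Subset n} {m x} → x ≤ m → S ∋ x → Covers (smallFamily m) S
  small-covers {S = S} {x = x} x≤m S∋x =
    [ x ] , ∈-map⁺ [_] (range1-∈ _ (n≢0⇒n>0 λ { refl → ∌0 S S∋x }) x≤m) , S∋x ∷ [] , [] ∷ [] , refl

  schur⇒witness : ∀ {n} {S : Subset n} → (∀ {x} → S ∋ x → 1 < x) → ProductSchur S →
                  ∃ λ w → S ∋ w × Witness (S ∋_) w
  schur⇒witness {S = S} S>1 schur = mono⇒witness (schur colouring)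
    where
    open Colouring (S ∋_) (λ x → member x S Bool.≟ true) S>1
    colouring = tabulate (red ∘ val)
    colours : ∀ j k → lookup colouring j ≡ lookup colouring k → red (val j) ≡ red (val k)
    colours j k eq = trans (sym (lookup∘tabulate (red ∘ val) j)) (trans eq (lookup∘tabulate (red ∘ val) k))
    mono⇒witness : MonoTriple S colouring → ∃ λ w → S ∋ w × Witness (S ∋_) w
    mono⇒witness (a , b , c , a∈ , b∈ , c∈ , a≡c , b≡c , ab≡c) =
      val c , ∈⇒∋ c∈ ,
      monochromatic⇒witness (∈⇒∋ a∈) (∈⇒∋ b∈) (∈⇒∋ c∈) (colours a c a≡c) (colours b c b≡c) ab≡c

  smallOrLarge : ∀ {n} (S : Subset n) m → (∃ λ x → x ≤ m × S ∋ x) ⊎ (∀ {x} → S ∋ x → m < x)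
  smallOrLarge S m with anyUpTo? (λ x → member x S Bool.≟ true) (suc m)
  ... | yes (x , s≤s x≤m , S∋x) = inj₁ (x , x≤m , S∋x)
  ... | no none = inj₂ λ {x} S∋x → ≰⇒> λ x≤m → none (x , s≤s x≤m , S∋x)

  families : ℕ → ℕ → List Family
  families n m = smallFamily m ∷ squareFamily n ∷ map (manyFamily n m) (upTo 9)

  -- An element up to `m` is caught by the first family. Otherwise all elements exceed `m ≥ 1`, as
  -- the colouring requires.
  families-cover : ∀ {n m} → 1 ≤ m → (S : Subset n) → ProductSchur S →
                   ∃ λ F → F ∈ₗ families n m × Covers F S
  families-cover {n} {m} 1≤m S schur = [ small , large ]′ (smallOrLarge S m)
    where
    Goal = ∃ λ F → F ∈ₗ families n m × Covers F S
    small : (∃ λ x → x ≤ m × S ∋ x) → Goal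
    small (x , x≤m , S∋x) = smallFamily m , here refl , small-covers {S = S} x≤m S∋x
    large : (∀ {x} → S ∋ x → m < x) → Goal
    large S>m = found (schur⇒witness {S = S} (λ S∋x → ≤-<-trans 1≤m (S>m S∋x)) schur)
      where
      many : (∃ λ R → R ≤ 8 × Covers (manyFamily n m R) S) → Goal
      many (R , R≤8 , cov) =
        manyFamily n m R , there (there (∈-map⁺ (manyFamily n m) (∈-upTo⁺ (s≤s R≤8)))) , cov
      found : (∃ λ w → S ∋ w × Witness (S ∋_) w) → Goal
      found (w , S∋w , inj₁ sq) = squareFamily n , there (here refl) , square-covers {S = S} S>m S∋w sq
      found (w , S∋w , inj₂ mw) = many (many-covers {S = S} S>m S∋w mw)

  -- This settles the case `m = n`: a Schur set is not empty, and its elements are at most `n`.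
  smallFamily-covers : ∀ {n} → 1 ≤ n → (S : Subset n) → ProductSchur S → Covers (smallFamily n) S
  smallFamily-covers {n} 1≤n S schur = [ small , ⊥-elim ∘ large ]′ (smallOrLarge S n)
    where
    small : (∃ λ x → x ≤ n × S ∋ x) → Covers (smallFamily n) S
    small (x , x≤n , S∋x) = small-covers {S = S} x≤n S∋x
    large : ¬ (∀ {x} → S ∋ x → n < x)
    large S>n = let w , S∋w , _ = schur⇒witness {S = S} (λ S∋x → ≤-<-trans 1≤n (S>n S∋x)) schur
                in <⇒≱ (S>n S∋w) (∋⇒≤ w S S∋w)

import Data.Integer as ℤ
import Data.Integer.Properties as ℤ
open import Data.Rational as ℚ using (ℚ; 0ℚ; 1ℚ; mkℚ; *<*; _≤_; _<_; _+_; _*_; _-_; -_)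
import Data.Rational.Properties as ℚ
open import Data.Rational.Solver using (module +-*-Solver)
open import Data.Rational.Unnormalised as ℚᵘ using (mkℚᵘ; *≤*)
import Data.Rational.Unnormalised.Properties as ℚᵘ

-- Union bound

∑ : ∀ {a} {A : Set a} → List A → (A → ℚ) → ℚ
∑ []       f = 0ℚ
∑ (x ∷ xs) f = f x + ∑ xs f

module _ {a} {A : Set a} where

  ∑-++ : ∀ xs ys (f : A → ℚ) → ∑ (xs ++ ys) f ≡ ∑ xs f + ∑ ys f
  ∑-++ []       ys f = sym (ℚ.+-identityˡ _)
  ∑-++ (x ∷ xs) ys f = trans (cong (f x +_) (∑-++ xs ys f)) (sym (ℚ.+-assoc (f x) _ _))

  ∑-cong : ∀ xs {f g : A → ℚ} → (∀ x → f x ≡ g x) → ∑ xs f ≡ ∑ xs g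
  ∑-cong []       eq = refl
  ∑-cong (x ∷ xs) eq = cong₂ _+_ (eq x) (∑-cong xs eq)

  ∑-*ˡ : ∀ c xs (f : A → ℚ) → ∑ xs (λ x → c * f x) ≡ c * ∑ xs f
  ∑-*ˡ c []       f = sym (ℚ.*-zeroʳ c)
  ∑-*ˡ c (x ∷ xs) f = trans (cong (c * f x +_) (∑-*ˡ c xs f)) (sym (ℚ.*-distribˡ-+ c (f x) _))

  ∑-0 : ∀ (xs : List A) → ∑ xs (λ _ → 0ℚ) ≡ 0ℚ
  ∑-0 []       = refl
  ∑-0 (x ∷ xs) = trans (ℚ.+-identityˡ _) (∑-0 xs)

  ∑-+ : ∀ xs (f g : A → ℚ) → ∑ xs (λ x → f x + g x) ≡ ∑ xs f + ∑ xs g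
  ∑-+ []       f g = refl
  ∑-+ (x ∷ xs) f g = trans (cong (f x + g x +_) (∑-+ xs f g))
    (solve 4 (λ a b c d → (a :+ b) :+ (c :+ d) := (a :+ c) :+ (b :+ d)) refl (f x) (g x) (∑ xs f) (∑ xs g))
    where open +-*-Solver

  ∑-nonNeg : ∀ xs {f : A → ℚ} → (∀ x → 0ℚ ≤ f x) → 0ℚ ≤ ∑ xs f
  ∑-nonNeg []       0≤f = ℚ.≤-refl
  ∑-nonNeg (x ∷ xs) 0≤f = ℚ.+-mono-≤ (0≤f x) (∑-nonNeg xs 0≤f)

  term≤∑ : ∀ {xs x} {f : A → ℚ} → (∀ y → 0ℚ ≤ f y) → x ∈ₗ xs → f x ≤ ∑ xs f
  term≤∑ {xs = y ∷ xs} {f = f} 0≤f (here refl) =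
    subst (_≤ f y + ∑ xs f) (ℚ.+-identityʳ (f y)) (ℚ.+-monoʳ-≤ (f y) (∑-nonNeg xs 0≤f))
  term≤∑ {xs = y ∷ xs} {x} {f} 0≤f (there x∈xs) =
    subst (_≤ f y + ∑ xs f) (ℚ.+-identityˡ (f x)) (ℚ.+-mono-≤ (0≤f y) (term≤∑ 0≤f x∈xs))

∑-map : ∀ {a b} {A : Set a} {B : Set b} (h : A → B) xs (f : B → ℚ) →
        ∑ (map h xs) f ≡ ∑ xs (λ x → f (h x))
∑-map h []       f = refl
∑-map h (x ∷ xs) f = cong (f (h x) +_) (∑-map h xs f)

∑-swap : ∀ {a b} {A : Set a} {B : Set b} xs ys (f : A → B → ℚ) →
         ∑ xs (λ x → ∑ ys (f x)) ≡ ∑ ys (λ y → ∑ xs (λ x → f x y))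
∑-swap []       ys f = sym (∑-0 ys)
∑-swap (x ∷ xs) ys f = trans (cong (∑ ys (f x) +_) (∑-swap xs ys f))
                             (sym (∑-+ ys (f x) (λ y → ∑ xs (λ x → f x y))))

*-nonNeg : ∀ {x y} → 0ℚ ≤ x → 0ℚ ≤ y → 0ℚ ≤ x * y
*-nonNeg {x} {y} 0≤x 0≤y =
  subst (_≤ x * y) (ℚ.*-zeroʳ x) (ℚ.*-monoˡ-≤-nonNeg x {{ℚ.nonNegative 0≤x}} 0≤y)

weight≥0 : ∀ {p} → 0ℚ ≤ p → p ≤ 1ℚ → ∀ {n} (S : Subset n) → 0ℚ ≤ weight p S
weight≥0 0≤p p≤1 []          = ℚ.nonNegative⁻¹ 1ℚ
weight≥0 0≤p p≤1 (true  ∷ S) = *-nonNeg 0≤p (weight≥0 0≤p p≤1 S)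
weight≥0 {p} 0≤p p≤1 (false ∷ S) =
  *-nonNeg (subst (_≤ 1ℚ - p) (ℚ.+-inverseʳ p) (ℚ.+-monoˡ-≤ (- p) p≤1)) (weight≥0 0≤p p≤1 S)

restrict : Bool → ℚ → ℚ
restrict b x = if b then x else 0ℚ

restrict-* : ∀ b c x → restrict b (c * x) ≡ c * restrict b x
restrict-* true  c x = refl
restrict-* false c x = sym (ℚ.*-zeroʳ c)

∑-subsets : ∀ n (f : Subset (suc n) → ℚ) →
  ∑ (subsets (suc n)) f ≡ ∑ (subsets n) (λ S → f (inside ∷ S)) + ∑ (subsets n) (λ S → f (outside ∷ S))
∑-subsets n f = trans (∑-++ (map (inside ∷_) (subsets n)) _ f)
                      (cong₂ _+_ (∑-map _ (subsets n) f) (∑-map _ (subsets n) f))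

p+[1-p] : ∀ p x → p * x + (1ℚ - p) * x ≡ x
p+[1-p] = solve 2 (λ p x → p :* x :+ (con 1ℚ :- p) :* x := x) refl
  where open +-*-Solver

-- Each coordinate in `T` contributes a factor `p`, every other one `p + (1 - p) = 1`.
Pr[⊆] : ∀ p {n} (T : Subset n) →
        ∑ (subsets n) (λ S → restrict (T ⊆ᵇ S) (weight p S)) ≡ p ^ℚ ∣ T ∣
Pr[⊆] p [] = ℚ.+-identityʳ 1ℚ
Pr[⊆] p {suc n} (true ∷ T) = begin
  ∑ (subsets (suc n)) (λ S → restrict ((true ∷ T) ⊆ᵇ S) (weight p S))
    ≡⟨ ∑-subsets n _ ⟩
  ∑ (subsets n) (λ S → restrict (T ⊆ᵇ S) (p * weight p S)) + ∑ (subsets n) (λ _ → 0ℚ)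
    ≡⟨ cong₂ _+_ (∑-cong (subsets n) (λ S → restrict-* (T ⊆ᵇ S) p (weight p S))) (∑-0 (subsets n)) ⟩
  ∑ (subsets n) (λ S → p * restrict (T ⊆ᵇ S) (weight p S)) + 0ℚ
    ≡⟨ ℚ.+-identityʳ _ ⟩
  ∑ (subsets n) (λ S → p * restrict (T ⊆ᵇ S) (weight p S))
    ≡⟨ ∑-*ˡ p (subsets n) _ ⟩
  p * ∑ (subsets n) (λ S → restrict (T ⊆ᵇ S) (weight p S))
    ≡⟨ cong (p *_) (Pr[⊆] p T) ⟩
  p * (p ^ℚ ∣ T ∣) ∎
  where open ≡-Reasoning
Pr[⊆] p {suc n} (false ∷ T) = begin
  ∑ (subsets (suc n)) (λ S → restrict ((false ∷ T) ⊆ᵇ S) (weight p S))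
    ≡⟨ ∑-subsets n _ ⟩
  ∑ (subsets n) (λ S → restrict (T ⊆ᵇ S) (p * weight p S)) +
  ∑ (subsets n) (λ S → restrict (T ⊆ᵇ S) ((1ℚ - p) * weight p S))
    ≡⟨ cong₂ _+_ (scale p) (scale (1ℚ - p)) ⟩
  p * Σ′ + (1ℚ - p) * Σ′
    ≡⟨ p+[1-p] p Σ′ ⟩
  Σ′
    ≡⟨ Pr[⊆] p T ⟩
  p ^ℚ ∣ T ∣ ∎
  where
  open ≡-Reasoning
  Σ′ = ∑ (subsets n) (λ S → restrict (T ⊆ᵇ S) (weight p S))
  scale : ∀ c → ∑ (subsets n) (λ S → restrict (T ⊆ᵇ S) (c * weight p S)) ≡ c * Σ′
  scale c = trans (∑-cong (subsets n) (λ S → restrict-* (T ⊆ᵇ S) c (weight p S))) (∑-*ˡ c (subsets n) _)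

∑-weight : ∀ p n → ∑ (subsets n) (weight p) ≡ 1ℚ
∑-weight p zero    = ℚ.+-identityʳ 1ℚ
∑-weight p (suc n) = begin
  ∑ (subsets (suc n)) (weight p)
    ≡⟨ ∑-subsets n (weight p) ⟩
  ∑ (subsets n) (λ S → p * weight p S) + ∑ (subsets n) (λ S → (1ℚ - p) * weight p S)
    ≡⟨ cong₂ _+_ (∑-*ˡ p (subsets n) _) (∑-*ˡ (1ℚ - p) (subsets n) _) ⟩
  p * ∑ (subsets n) (weight p) + (1ℚ - p) * ∑ (subsets n) (weight p)
    ≡⟨ p+[1-p] p _ ⟩
  ∑ (subsets n) (weight p)
    ≡⟨ ∑-weight p n ⟩
  1ℚ ∎
  where open ≡-Reasoning

-- `f` stands for the summation inside `probNotPS`, known through its three equations. The weight of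
-- an outcome is accounted for by `g` if it is Schur and by `f` otherwise.
∑-weight≤ : ∀ {n p} {g : Subset n → ℚ} (f : List (Subset n) → ℚ) →
  f [] ≡ 0ℚ →
  (∀ S Ss → ProductSchur S → f (S ∷ Ss) ≡ f Ss) →
  (∀ S Ss → ¬ ProductSchur S → f (S ∷ Ss) ≡ weight p S + f Ss) →
  (∀ S → 0ℚ ≤ g S) → (∀ S → ProductSchur S → weight p S ≤ g S) →
  ∀ Ss → ∑ Ss (weight p) ≤ f Ss + ∑ Ss g
∑-weight≤ f f[] yes! no! 0≤g w≤g [] rewrite f[] = ℚ.≤-refl
∑-weight≤ {p = p} {g} f f[] yes! no! 0≤g w≤g (S ∷ Ss) with ∑-weight≤ {p = p} f f[] yes! no! 0≤g w≤g Ss | productSchur? S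
... | ih | yes ps rewrite yes! S Ss ps = begin
  weight p S + ∑ Ss (weight p) ≤⟨ ℚ.+-mono-≤ (w≤g S ps) ih ⟩
  g S + (f Ss + ∑ Ss g)        ≡⟨ solve 3 (λ a b c → a :+ (b :+ c) := b :+ (a :+ c)) refl (g S) (f Ss) (∑ Ss g) ⟩
  f Ss + (g S + ∑ Ss g)        ∎
  where open ℚ.≤-Reasoning
        open +-*-Solver
... | ih | no ¬ps rewrite no! S Ss ¬ps = begin
  weight p S + ∑ Ss (weight p)       ≤⟨ ℚ.+-monoʳ-≤ (weight p S) ih ⟩
  weight p S + (f Ss + ∑ Ss g)       ≡⟨ ℚ.+-assoc (weight p S) (f Ss) (∑ Ss g) ⟨
  weight p S + f Ss + ∑ Ss g         ≡⟨ cong (weight p S + f Ss +_) (ℚ.+-identityˡ (∑ Ss g)) ⟨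
  weight p S + f Ss + (0ℚ + ∑ Ss g)  ≤⟨ ℚ.+-monoʳ-≤ (weight p S + f Ss) (ℚ.+-monoˡ-≤ (∑ Ss g) (0≤g S)) ⟩
  weight p S + f Ss + (g S + ∑ Ss g) ∎
  where open ℚ.≤-Reasoning

-- The summation function inside probNotPS is local to Defs; once the list of
-- subsets is abstracted, pattern unification recovers it as notPSSum.
mutual
  notPSSum : ∀ p n → List (Subset n) → ℚ
  notPSSum = _

  notPSSum-subsets : ∀ p n → notPSSum p n (subsets n) ≡ probNotPS p n
  notPSSum-subsets p n with subsets n
  ... | Ss = refl

1≤probNotPS+ : ∀ p n (g : Subset n → ℚ) →
  (∀ S → 0ℚ ≤ g S) → (∀ S → ProductSchur S → weight p S ≤ g S) →
  1ℚ ≤ probNotPS p n + ∑ (subsets n) g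
1≤probNotPS+ p n g 0≤g w≤g =
  subst (_≤ probNotPS p n + ∑ (subsets n) g) (∑-weight p n)
        (∑-weight≤ {p = p} f refl yes! no! 0≤g w≤g (subsets n))
  where
  f = notPSSum p n
  yes! : ∀ S Ss → ProductSchur S → f (S ∷ Ss) ≡ f Ss
  yes! S Ss ps with productSchur? S
  ... | yes _  = refl
  ... | no ¬ps = ⊥-elim (¬ps ps)
  no! : ∀ S Ss → ¬ ProductSchur S → f (S ∷ Ss) ≡ weight p S + f Ss
  no! S Ss ¬ps with productSchur? S
  ... | yes ps = ⊥-elim (¬ps ps)
  ... | no _   = refl

-- A Schur outcome contains some `T`, so its weight is among the terms of its inner sum; exchanging
-- the sums leaves the probabilities computed in `Pr[⊆]`.
unionBound : ∀ {p} → 0ℚ ≤ p → p ≤ 1ℚ → ∀ n (Ts : List (Subset n)) →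
  (∀ S → ProductSchur S → ∃ λ T → T ∈ₗ Ts × T ⊆ᵇ S ≡ true) →
  1ℚ ≤ probNotPS p n + ∑ Ts (λ T → p ^ℚ ∣ T ∣)
unionBound {p} 0≤p p≤1 n Ts cover =
  subst (λ x → 1ℚ ≤ probNotPS p n + x)
        (trans (∑-swap (subsets n) Ts term) (∑-cong Ts (Pr[⊆] p)))
        (1≤probNotPS+ p n (λ S → ∑ Ts (term S)) (λ S → ∑-nonNeg Ts (term≥0 S)) w≤)
  where
  term : Subset n → Subset n → ℚ
  term S T = restrict (T ⊆ᵇ S) (weight p S)
  term≥0 : ∀ S T → 0ℚ ≤ term S T
  term≥0 S T with T ⊆ᵇ S
  ... | true  = weight≥0 0≤p p≤1 S
  ... | false = ℚ.≤-refl
  w≤ : ∀ S → ProductSchur S → weight p S ≤ ∑ Ts (term S)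
  w≤ S ps with cover S ps
  ... | T , T∈Ts , T⊆S =
    subst (_≤ ∑ Ts (term S)) (cong (λ b → restrict b (weight p S)) T⊆S) (term≤∑ (term≥0 S) T∈Ts)

-- Expected counts

-- Opaque because unfolding ℕ→ℚ exposes the gcd computations of normalisation.
opaque
  ι : ℕ → ℚ
  ι = ℕ→ℚ

  ι≡ : ∀ n → ι n ≡ ℕ→ℚ n
  ι≡ n = refl

  ι-0 : ι 0 ≡ 0ℚ
  ι-0 = refl

  ι-1 : ι 1 ≡ 1ℚ
  ι-1 = refl

  toℚᵘ-ι : ∀ n → ℚ.toℚᵘ (ι n) ℚᵘ.≃ mkℚᵘ (ℤ.+ n) 0
  toℚᵘ-ι n = ℚ.toℚᵘ-fromℚᵘ (mkℚᵘ (ℤ.+ n) 0)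

ι-* : ∀ m n → ι (m ℕ.* n) ≡ ι m * ι n
ι-* m n = ℚ.toℚᵘ-injective (begin
  ℚ.toℚᵘ (ι (m ℕ.* n))                       ≈⟨ toℚᵘ-ι (m ℕ.* n) ⟩
  mkℚᵘ (ℤ.+ (m ℕ.* n)) 0                        ≈⟨ ℚᵘ.≃-reflexive (cong (λ i → mkℚᵘ i 0) (ℤ.pos-* m n)) ⟩
  mkℚᵘ (ℤ.+ m) 0 ℚᵘ.* mkℚᵘ (ℤ.+ n) 0            ≈⟨ ℚᵘ.*-cong (toℚᵘ-ι m) (toℚᵘ-ι n) ⟨
  ℚ.toℚᵘ (ι m) ℚᵘ.* ℚ.toℚᵘ (ι n)            ≈⟨ ℚ.toℚᵘ-homo-* (ι m) (ι n) ⟨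
  ℚ.toℚᵘ (ι m * ι n)                        ∎)
  where open import Relation.Binary.Reasoning.Setoid ℚᵘ.≃-setoid

ι-suc : ∀ n → ι (suc n) ≡ 1ℚ + ι n
ι-suc n = ℚ.toℚᵘ-injective (begin
  ℚ.toℚᵘ (ι (suc n))                ≈⟨ toℚᵘ-ι (suc n) ⟩
  mkℚᵘ (ℤ.+ suc n) 0                   ≈⟨ ℚᵘ.≃-reflexive (cong (λ i → mkℚᵘ (ℤ.+ suc i) 0) (sym (ℕ.*-identityʳ n))) ⟩
  mkℚᵘ (ℤ.+ suc (n ℕ.* 1)) 0           ≈⟨ ℚᵘ.≃-reflexive (cong (λ i → mkℚᵘ (ℤ.+ 1 ℤ.+ i) 0) (ℤ.pos-* n 1)) ⟩
  ℚᵘ.1ℚᵘ ℚᵘ.+ mkℚᵘ (ℤ.+ n) 0           ≈⟨ ℚᵘ.+-cong ℚᵘ.≃-refl (toℚᵘ-ι n) ⟨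
  ℚᵘ.1ℚᵘ ℚᵘ.+ ℚ.toℚᵘ (ι n)           ≈⟨ ℚ.toℚᵘ-homo-+ 1ℚ (ι n) ⟨
  ℚ.toℚᵘ (1ℚ + ι n)                  ∎)
  where open import Relation.Binary.Reasoning.Setoid ℚᵘ.≃-setoid

ι-mono-≤ : ∀ {m n} → m ℕ.≤ n → ι m ≤ ι n
ι-mono-≤ {m} {n} m≤n = ℚ.toℚᵘ-cancel-≤
  (ℚᵘ.≤-respˡ-≃ (ℚᵘ.≃-sym (toℚᵘ-ι m)) (ℚᵘ.≤-respʳ-≃ (ℚᵘ.≃-sym (toℚᵘ-ι n))
    (*≤* (ℤ.*-monoʳ-≤-nonNeg ℤ.1ℤ (ℤ.+≤+ m≤n)))))

ι≥0 : ∀ n → 0ℚ ≤ ι n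
ι≥0 n = subst (_≤ ι n) ι-0 (ι-mono-≤ z≤n)

*-mono-≤-nonNeg : ∀ {a b c e} → 0ℚ ≤ a → 0ℚ ≤ e → a ≤ b → c ≤ e → a * c ≤ b * e
*-mono-≤-nonNeg {a} {b} {c} {e} 0≤a 0≤e a≤b c≤e =
  ℚ.≤-trans (ℚ.*-monoˡ-≤-nonNeg a {{ℚ.nonNegative 0≤a}} c≤e) (ℚ.*-monoʳ-≤-nonNeg e {{ℚ.nonNegative 0≤e}} a≤b)

x≤x*y : ∀ {x y} → 0ℚ ≤ x → 1ℚ ≤ y → x ≤ x * y
x≤x*y {x} {y} 0≤x 1≤y = subst (_≤ x * y) (ℚ.*-identityʳ x) (ℚ.*-monoˡ-≤-nonNeg x {{ℚ.nonNegative 0≤x}} 1≤y)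

0≤1 : 0ℚ ≤ 1ℚ
0≤1 = ℚ.nonNegative⁻¹ 1ℚ

^ℚ≥0 : ∀ {x} → 0ℚ ≤ x → ∀ k → 0ℚ ≤ x ^ℚ k
^ℚ≥0 0≤x zero    = 0≤1
^ℚ≥0 0≤x (suc k) = *-nonNeg 0≤x (^ℚ≥0 0≤x k)

1≤^ℚ : ∀ {x} → 1ℚ ≤ x → ∀ k → 1ℚ ≤ x ^ℚ k
1≤^ℚ 1≤x zero    = ℚ.≤-refl
1≤^ℚ 1≤x (suc k) = ℚ.≤-trans 1≤x (x≤x*y (ℚ.≤-trans 0≤1 1≤x) (1≤^ℚ 1≤x k))

-- This serves in place of roots: `small-cost` passes to ninth powers and `square-cost` to squares.
≤1-from-^ : ∀ {x} k → x ^ℚ suc k ≤ 1ℚ → x ≤ 1ℚ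
≤1-from-^ {x} k x^≤1 with ℚ.≤-total x 1ℚ
... | inj₁ x≤1 = x≤1
... | inj₂ 1≤x = ℚ.≤-trans (x≤x*y (ℚ.≤-trans 0≤1 1≤x) (1≤^ℚ 1≤x k)) x^≤1

^ℚ-+ : ∀ x j k → x ^ℚ (j ℕ.+ k) ≡ x ^ℚ j * x ^ℚ k
^ℚ-+ x zero    k = sym (ℚ.*-identityˡ _)
^ℚ-+ x (suc j) k = trans (cong (x *_) (^ℚ-+ x j k)) (sym (ℚ.*-assoc x _ _))

[ι*]^ : ∀ n x k → (ι n * x) ^ℚ k ≡ ι (n ^ k) * x ^ℚ k
[ι*]^ n x zero    = trans (sym (ℚ.*-identityˡ 1ℚ)) (cong (_* 1ℚ) (sym ι-1))
[ι*]^ n x (suc k) = begin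
  ι n * x * (ι n * x) ^ℚ k             ≡⟨ cong (ι n * x *_) ([ι*]^ n x k) ⟩
  ι n * x * (ι (n ^ k) * x ^ℚ k)       ≡⟨ solve 4 (λ a x b y → a :* x :* (b :* y) := (a :* b) :* (x :* y)) refl (ι n) x (ι (n ^ k)) (x ^ℚ k) ⟩
  ι n * ι (n ^ k) * (x * x ^ℚ k)       ≡⟨ cong (_* (x * x ^ℚ k)) (ι-* n (n ^ k)) ⟨
  ι (n ^ suc k) * x ^ℚ suc k             ∎
  where open ≡-Reasoning
        open +-*-Solver

ι-archimedean : ∀ {ε} → 0ℚ < ε → ∃ λ b → 1ℚ ≤ ι b * ε
ι-archimedean {ε@(mkℚ (ℤ.+ zero) b _)} (*<* (ℤ.+<+ ()))
-- The field `b` of `mkℚ` is one less than the denominator, so `suc b` times `ε` is the numerator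
-- `suc a`.
ι-archimedean {ε@(mkℚ (ℤ.+ suc a) b _)} _ = suc b , ℚ.toℚᵘ-cancel-≤
  (ℚᵘ.≤-respʳ-≃ (ℚᵘ.≃-sym (ℚᵘ.≃-trans (ℚ.toℚᵘ-homo-* (ι (suc b)) ε) (ℚᵘ.*-congʳ {ℚ.toℚᵘ ε} (toℚᵘ-ι (suc b)))))
    (*≤* (ℤ.+≤+ le)))
  where
  le : 1 ℕ.* suc (b ℕ.+ 0) ℕ.≤ suc b ℕ.* suc a ℕ.* 1
  le = subst₂ ℕ._≤_ (sym (trans (ℕ.*-identityˡ _) (cong suc (ℕ.+-identityʳ b)))) (sym (ℕ.*-identityʳ _))
         (ℕ.m≤m*n (suc b) (suc a))


-- 17 = 8 + 8 + 1: the choices of divisors, the bounds (m + 1) p δ ≥ 1 for R ≤ 8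
-- repetitions, and one spare factor δ that makes each expected count O(1 / δ).
record Sparse (p : ℚ) (n δ : ℕ) : Set where
  constructor sparse
  field
    0≤p    : 0ℚ ≤ p
    p≤1    : p ≤ 1ℚ
    1≤n    : 1 ℕ.≤ n
    1≤δ    : 1 ℕ.≤ δ
    bound  : ι (n ℕ.* δ ^ 17) * p ^ℚ 9 ≤ 1ℚ

module _ {p n δ} (sp : Sparse p n δ) where
  open Sparse sp
  open ℚ.≤-Reasoning

  p^≥0 : ∀ k → 0ℚ ≤ p ^ℚ k
  p^≥0 = ^ℚ≥0 0≤p

  δ^-mono : ∀ {j k} → j ℕ.≤ k → δ ^ j ℕ.≤ δ ^ k
  δ^-mono = ℕ.^-monoʳ-≤ δ {{ℕ.>-nonZero 1≤δ}}

  bound≤ : ∀ {a} → a ℕ.≤ n ℕ.* δ ^ 17 → ι a * p ^ℚ 9 ≤ 1ℚ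
  bound≤ a≤ = ℚ.≤-trans (ℚ.*-monoʳ-≤-nonNeg (p ^ℚ 9) {{ℚ.nonNegative (p^≥0 9)}} (ι-mono-≤ a≤)) bound

  -- The ninth power of δ p is at most n δ^17 p^9. The bound starts the search in `threshold` at 1.
  small-cost : ι δ * p ≤ 1ℚ
  small-cost = ≤1-from-^ 8 (ℚ.≤-trans (ℚ.≤-reflexive ([ι*]^ δ p 9))
    (bound≤ (ℕ.≤-trans (δ^-mono (ℕ.m≤m+n 9 8)) (ℕ.m≤n*m (δ ^ 17) n {{ℕ.>-nonZero 1≤n}}))))

  -- The square of r δ^5 p^5 is at most n δ^10 p^10, which `bound` controls with a surplus factor
  -- `p ≤ 1`.
  square-cost : ∀ {r l} → r ℕ.* r ℕ.≤ n → l ℕ.≤ r ℕ.* δ ^ 4 → ι (l ℕ.* δ) * p ^ℚ 5 ≤ 1ℚ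
  square-cost {r} {l} r²≤n l≤ = begin
    ι (l ℕ.* δ) * p ^ℚ 5    ≤⟨ ℚ.*-monoʳ-≤-nonNeg (p ^ℚ 5) {{ℚ.nonNegative (p^≥0 5)}} (ι-mono-≤ (ℕ.*-monoˡ-≤ δ l≤)) ⟩
    ι a * p ^ℚ 5            ≤⟨ ≤1-from-^ 1 squared ⟩
    1ℚ                      ∎
    where
    a = r ℕ.* δ ^ 4 ℕ.* δ
    a²≤ : a ^ 2 ℕ.≤ n ℕ.* δ ^ 17
    a²≤ = ℕ.≤-trans (ℕ.≤-reflexive (trans
        (solve 3 (λ r x δ → (r :* x :* δ) :* ((r :* x :* δ) :* con 1) := (r :* r) :* ((x :* δ) :* (x :* δ))) refl r (δ ^ 4) δ)
        (cong (r ℕ.* r ℕ.*_) (trans (cong₂ ℕ._*_ (ℕ.*-comm (δ ^ 4) δ) (ℕ.*-comm (δ ^ 4) δ)) (sym (ℕ.^-distribˡ-+-* δ 5 5))))))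
      (ℕ.*-mono-≤ r²≤n (δ^-mono (ℕ.m≤m+n 10 7)))
      where open Data.Nat.Solver.+-*-Solver
    squared : (ι a * p ^ℚ 5) ^ℚ 2 ≤ 1ℚ
    squared = begin
      (ι a * p ^ℚ 5) ^ℚ 2          ≡⟨ [ι*]^ a (p ^ℚ 5) 2 ⟩
      ι (a ^ 2) * (p ^ℚ 5) ^ℚ 2    ≡⟨ cong (λ x → ι (a ^ 2) * (p ^ℚ 5 * x)) (ℚ.*-identityʳ (p ^ℚ 5)) ⟩
      ι (a ^ 2) * (p ^ℚ 5 * p ^ℚ 5) ≡⟨ cong (ι (a ^ 2) *_) (^ℚ-+ p 5 5) ⟨
      ι (a ^ 2) * p ^ℚ (1 ℕ.+ 9)   ≡⟨ cong (ι (a ^ 2) *_) (ℚ.*-comm p (p ^ℚ 9)) ⟩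
      ι (a ^ 2) * (p ^ℚ 9 * p)     ≡⟨ ℚ.*-assoc (ι (a ^ 2)) (p ^ℚ 9) p ⟨
      ι (a ^ 2) * p ^ℚ 9 * p       ≤⟨ *-mono-≤-nonNeg (*-nonNeg (ι≥0 (a ^ 2)) (p^≥0 9)) 0≤1 (bound≤ a²≤) p≤1 ⟩
      1ℚ * 1ℚ                      ≡⟨ ℚ.*-identityˡ 1ℚ ⟩
      1ℚ                           ∎

  -- Multiplying by (M δ p)^R ≥ 1 restores the ninth power of `p`, and `q M^R ≤ n` absorbs the
  -- powers of `M`. The exponent of δ becomes 9 + R ≤ 17.
  many-cost : ∀ {M q l} R → R ℕ.≤ 8 → q ℕ.* M ^ R ℕ.≤ n → l ℕ.≤ q ℕ.* δ ^ 8 → 1ℚ ≤ ι (M ℕ.* δ) * p →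
              ι (l ℕ.* δ) * p ^ℚ (9 ∸ R) ≤ 1ℚ
  many-cost {M} {q} {l} R R≤8 qM≤n l≤ 1≤Mδp = begin
    ι (l ℕ.* δ) * p ^ℚ k
      ≤⟨ ℚ.*-monoʳ-≤-nonNeg (p ^ℚ k) {{ℚ.nonNegative (p^≥0 k)}} (ι-mono-≤ (ℕ.*-monoˡ-≤ δ l≤)) ⟩
    ι a * p ^ℚ k
      ≤⟨ x≤x*y (*-nonNeg (ι≥0 a) (p^≥0 k)) (1≤^ℚ 1≤Mδp R) ⟩
    ι a * p ^ℚ k * (ι (M ℕ.* δ) * p) ^ℚ R
      ≡⟨ cong (ι a * p ^ℚ k *_) ([ι*]^ (M ℕ.* δ) p R) ⟩
    ι a * p ^ℚ k * (ι b * p ^ℚ R)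
      ≡⟨ solve 4 (λ a x b y → (a :* x) :* (b :* y) := (a :* b) :* (x :* y)) refl (ι a) (p ^ℚ k) (ι b) (p ^ℚ R) ⟩
    ι a * ι b * (p ^ℚ k * p ^ℚ R)
      ≡⟨ cong₂ _*_ (ι-* a b) (trans (cong (p ^ℚ_) (sym (ℕ.m∸n+n≡m (ℕ.m≤n⇒m≤1+n R≤8)))) (^ℚ-+ p k R)) ⟨
    ι (a ℕ.* b) * p ^ℚ 9
      ≤⟨ bound≤ ab≤ ⟩
    1ℚ ∎
    where
    open +-*-Solver
    k = 9 ∸ R
    a = q ℕ.* δ ^ 8 ℕ.* δ
    b = (M ℕ.* δ) ^ R
    ab≤ : a ℕ.* b ℕ.≤ n ℕ.* δ ^ 17
    ab≤ = ℕ.≤-trans (ℕ.≤-reflexive (trans (cong (a ℕ.*_) (^-distribʳ M δ R)) (trans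
        (ℕsolve 5 (λ q x δ y z → (q ⊗ x ⊗ δ) ⊗ (y ⊗ z) ⊜ (q ⊗ y) ⊗ (δ ⊗ x ⊗ z)) refl q (δ ^ 8) δ (M ^ R) (δ ^ R))
        (cong (q ℕ.* M ^ R ℕ.*_) (sym (ℕ.^-distribˡ-+-* δ 9 R))))))
      (ℕ.*-mono-≤ qM≤n (δ^-mono (ℕ.+-monoʳ-≤ 9 R≤8)))
      where
      open Data.Nat.Solver.+-*-Solver using () renaming (solve to ℕsolve; _:*_ to _⊗_; _:=_ to _⊜_)
      ^-distribʳ : ∀ x y k → (x ℕ.* y) ^ k ≡ x ^ k ℕ.* y ^ k
      ^-distribʳ x y zero    = refl
      ^-distribʳ x y (suc k) = trans (cong (x ℕ.* y ℕ.*_) (^-distribʳ x y k))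
        (ℕsolve 4 (λ x y a b → (x ⊗ y) ⊗ (a ⊗ b) ⊜ (x ⊗ a) ⊗ (y ⊗ b)) refl x y (x ^ k) (y ^ k))

  -- The search looks for the largest `m ≤ n` that keeps the small family cheap. If it stops early,
  -- the failure at `m + 1` is the inequality that `many-cost` needs; if it reaches `n`, the small
  -- family alone covers all Schur sets.
  threshold : ∃ λ m → 1 ℕ.≤ m × ι (m ℕ.* δ) * p ≤ 1ℚ × (m ≡ n ⊎ 1ℚ ≤ ι (suc m ℕ.* δ) * p)
  threshold = search n 1≤n
    where
    search : ∀ k → 1 ℕ.≤ k → ∃ λ m → 1 ℕ.≤ m × ι (m ℕ.* δ) * p ≤ 1ℚ × (m ≡ k ⊎ 1ℚ ≤ ι (suc m ℕ.* δ) * p)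
    search (suc zero) _ =
      1 , ℕ.≤-refl , subst (λ x → ι x * p ≤ 1ℚ) (sym (ℕ.*-identityˡ δ)) small-cost , inj₁ refl
    search (suc (suc k)) _ with search (suc k) (s≤s z≤n)
    ... | m , 1≤m , m-ok , inj₂ next   = m , 1≤m , m-ok , inj₂ next
    ... | m , 1≤m , m-ok , inj₁ refl with ℚ.≤-total (ι (suc m ℕ.* δ) * p) 1ℚ
    ... | inj₁ ok   = suc m , s≤s z≤n , ok , inj₁ refl
    ... | inj₂ next = m , 1≤m , m-ok , inj₂ next

-- Summing over the families

∑-constant : ∀ {a} {A : Set a} xs {f : A → ℚ} {c} → (∀ {x} → x ∈ₗ xs → f x ≡ c) → ∑ xs f ≡ ι (length xs) * c
∑-constant [] {c = c} f≡c = sym (trans (cong (_* c) ι-0) (ℚ.*-zeroˡ c))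
∑-constant (x ∷ xs) {f} {c} f≡c = begin
  f x + ∑ xs f                ≡⟨ cong₂ _+_ (f≡c (here refl)) (∑-constant xs (f≡c ∘ there)) ⟩
  c + ι (length xs) * c       ≡⟨ solve 2 (λ c l → c :+ l :* c := (con 1ℚ :+ l) :* c) refl c (ι (length xs)) ⟩
  (1ℚ + ι (length xs)) * c    ≡⟨ cong (_* c) (ι-suc (length xs)) ⟨
  ι (suc (length xs)) * c     ∎
  where open ≡-Reasoning
        open +-*-Solver

∑-concatMap : ∀ {a b} {A : Set a} {B : Set b} (g : A → List B) xs (f : B → ℚ) →
              ∑ (concatMap g xs) f ≡ ∑ xs (λ x → ∑ (g x) f)
∑-concatMap g []       f = refl
∑-concatMap g (x ∷ xs) f = trans (∑-++ (g x) (concatMap g xs) f) (cong (∑ (g x) f +_) (∑-concatMap g xs f))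

-- Lists with repetitions or entries out of range give sets that are too small. The filter drops
-- them, so every remaining set has probability exactly `p ^ℚ k`.
members : ∀ n → Family → List (Subset n)
members n (k , Ls) = filter (λ T → ∣ T ∣ ℕ.≟ k) (map fromList Ls)

covers⇒member : ∀ {n} {S : Subset n} F → Covers F S → ∃ λ T → T ∈ₗ members n F × T ⊆ᵇ S ≡ true
covers⇒member {S = S} (k , Ls) (L , L∈Ls , S∋L , L! , ∣L∣≡k) =
  fromList L ,
  ∈-filter⁺ (λ T → ∣ T ∣ ℕ.≟ k) (∈-map⁺ fromList L∈Ls) (trans (∣fromList∣ S S∋L L!) ∣L∣≡k) ,
  fromList-⊆ S S∋L

∑-members≤ : ∀ {p} → 0ℚ ≤ p → ∀ n k Ls →
             ∑ (members n (k , Ls)) (λ T → p ^ℚ ∣ T ∣) ≤ ι (length Ls) * p ^ℚ k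
∑-members≤ {p} 0≤p n k Ls = begin
  ∑ (members n (k , Ls)) (λ T → p ^ℚ ∣ T ∣)   ≡⟨ ∑-constant (members n (k , Ls)) size≡ ⟩
  ι (length (members n (k , Ls))) * p ^ℚ k    ≤⟨ ℚ.*-monoʳ-≤-nonNeg (p ^ℚ k) {{ℚ.nonNegative (^ℚ≥0 0≤p k)}} (ι-mono-≤ ∣members∣≤) ⟩
  ι (length Ls) * p ^ℚ k                      ∎
  where
  open ℚ.≤-Reasoning
  size≡ : ∀ {T} → T ∈ₗ members n (k , Ls) → p ^ℚ ∣ T ∣ ≡ p ^ℚ k
  size≡ T∈ = cong (p ^ℚ_) (proj₂ (∈-filter⁻ (λ T → ∣ T ∣ ℕ.≟ k) {xs = map fromList Ls} T∈))
  ∣members∣≤ : length (members n (k , Ls)) ℕ.≤ length Ls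
  ∣members∣≤ = ℕ.≤-trans (length-filter (λ T → ∣ T ∣ ℕ.≟ k) (map fromList Ls)) (ℕ.≤-reflexive (length-map fromList Ls))

-- The bound 1 / δ on an expected number of configurations, written without division.
Cheap : ℚ → ℕ → Family → Set
Cheap p δ (k , Ls) = ι (length Ls ℕ.* δ) * p ^ℚ k ≤ 1ℚ

cheap-∑ : ∀ {p} → 0ℚ ≤ p → ∀ n δ {Fs} → All (Cheap p δ) Fs →
          ∑ Fs (λ F → ∑ (members n F) (λ T → p ^ℚ ∣ T ∣)) * ι δ ≤ ι (length Fs)
cheap-∑ 0≤p n δ [] = ℚ.≤-reflexive (trans (ℚ.*-zeroˡ (ι δ)) (sym ι-0))
cheap-∑ {p} 0≤p n δ {(k , Ls) ∷ Fs} (cheap ∷ cheaps) = begin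
  (x + y) * ι δ               ≡⟨ ℚ.*-distribʳ-+ (ι δ) x y ⟩
  x * ι δ + y * ι δ           ≤⟨ ℚ.+-mono-≤ x≤1 (cheap-∑ 0≤p n δ cheaps) ⟩
  1ℚ + ι (length Fs)          ≡⟨ ι-suc (length Fs) ⟨
  ι (suc (length Fs))         ∎
  where
  open ℚ.≤-Reasoning
  x = ∑ (members n (k , Ls)) (λ T → p ^ℚ ∣ T ∣)
  y = ∑ Fs (λ F → ∑ (members n F) (λ T → p ^ℚ ∣ T ∣))
  x≤1 : x * ι δ ≤ 1ℚ
  x≤1 = begin
    x * ι δ                            ≤⟨ ℚ.*-monoʳ-≤-nonNeg (ι δ) {{ℚ.nonNegative (ι≥0 δ)}} (∑-members≤ 0≤p n k Ls) ⟩
    ι (length Ls) * p ^ℚ k * ι δ       ≡⟨ solve 3 (λ l x d → l :* x :* d := l :* d :* x) refl (ι (length Ls)) (p ^ℚ k) (ι δ) ⟩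
    ι (length Ls) * ι δ * p ^ℚ k       ≡⟨ cong (_* p ^ℚ k) (ι-* (length Ls) δ) ⟨
    ι (length Ls ℕ.* δ) * p ^ℚ k       ≤⟨ cheap ⟩
    1ℚ                                 ∎
    where open +-*-Solver

probNotPS-bound : ∀ {p n δ} → Sparse p n δ → ∀ Fs → All (Cheap p δ) Fs →
  (∀ S → ProductSchur S → ∃ λ F → F ∈ₗ Fs × Covers F S) →
  ∀ ε → ι (length Fs) ≤ ε * ι δ → 1ℚ - ε ≤ probNotPS p n
probNotPS-bound {p} {n} {δ} sp Fs cheaps cover ε small = begin
  1ℚ - ε                       ≤⟨ ℚ.+-monoˡ-≤ (- ε) 1≤ ⟩
  probNotPS p n + total - ε    ≤⟨ ℚ.+-monoˡ-≤ (- ε) (ℚ.+-monoʳ-≤ (probNotPS p n) total≤ε) ⟩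
  probNotPS p n + ε - ε        ≡⟨ solve 2 (λ x e → x :+ e :- e := x) refl (probNotPS p n) ε ⟩
  probNotPS p n                ∎
  where
  open ℚ.≤-Reasoning
  open +-*-Solver
  open Sparse sp
  total = ∑ Fs (λ F → ∑ (members n F) (λ T → p ^ℚ ∣ T ∣))
  cover′ : ∀ S → ProductSchur S → ∃ λ T → T ∈ₗ concatMap (members n) Fs × T ⊆ᵇ S ≡ true
  cover′ S schur =
    let F , F∈ , cov = cover S schur
        T , T∈ , T⊆S = covers⇒member {S = S} F cov
    in T , ∈-concatMap (members n) F∈ T∈ , T⊆S
  1≤ : 1ℚ ≤ probNotPS p n + total
  1≤ = subst (λ x → 1ℚ ≤ probNotPS p n + x) (∑-concatMap (members n) Fs _)
         (unionBound 0≤p p≤1 n (concatMap (members n) Fs) cover′)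
  total≤ε : total ≤ ε
  total≤ε = ℚ.*-cancelʳ-≤-pos (ι δ) {{ℚ.positive (ℚ.<-≤-trans (ℚ.positive⁻¹ 1ℚ) (subst (_≤ ι δ) ι-1 (ι-mono-≤ 1≤δ)))}}
    (ℚ.≤-trans (cheap-∑ 0≤p n δ cheaps) small)

-- Costs of the families and the limit

smallFamily-cheap : ∀ {p δ m} → ι (m ℕ.* δ) * p ≤ 1ℚ → Cheap p δ (smallFamily m)
smallFamily-cheap {p} {δ} {m} m-ok = subst (_≤ 1ℚ)
  (cong₂ (λ l x → ι (l ℕ.* δ) * x) (sym (length-smallLists m)) (sym (ℚ.*-identityʳ p))) m-ok

manyFamily-cheap : ∀ {p n m R} → Sparse p n (D n) → R ℕ.≤ 8 → 1ℚ ≤ ι (suc m ℕ.* D n) * p →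
                   Cheap p (D n) (manyFamily n m R)
manyFamily-cheap {n = n} {m} {R} sp R≤8 next =
  many-cost sp {suc m} {quotient n m R} R R≤8 (m/n*n≤m n (suc m ^ R))
    (length-manyLists≤ n (quotient n m R) R (m/n≤m n (suc m ^ R)) R≤8) next
  where instance _ = ℕ.m^n≢0 (suc m) R

families-cheap : ∀ {p n m} → Sparse p n (D n) → ι (m ℕ.* D n) * p ≤ 1ℚ → 1ℚ ≤ ι (suc m ℕ.* D n) * p →
                 All (Cheap p (D n)) (families n m)
families-cheap {p} {n} {m} sp m-ok next =
  smallFamily-cheap {p} {D n} {m} m-ok ∷
  square-cost sp {proj₁ (isqrt n)} (proj₁ (proj₂ (isqrt n))) (length-squareLists≤ n (proj₁ (isqrt n))) ∷
  All.map⁺ {f = manyFamily n m} (All.tabulate λ {R} R∈ → manyFamily-cheap {p} {n} {m} {R} sp (ℕ.≤-pred (∈-upTo⁻ R∈)) next)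

-- There are at most eleven families: the small one, the squares, and one for each `R` from 0 to 8.
sparse⇒probNotPS : ∀ {p n} → Sparse p n (D n) → ∀ ε → ι 11 ≤ ε * ι (D n) → 1ℚ - ε ≤ probNotPS p n
sparse⇒probNotPS {p} {n} sp ε 11≤ = go (threshold sp)
  where
  open Sparse sp
  go : (∃ λ m → 1 ℕ.≤ m × ι (m ℕ.* D n) * p ≤ 1ℚ × (m ≡ n ⊎ 1ℚ ≤ ι (suc m ℕ.* D n) * p)) →
       1ℚ - ε ≤ probNotPS p n
  go (m , 1≤m , m-ok , inj₂ next) =
    probNotPS-bound sp (families n m) (families-cheap {p} {n} {m} sp m-ok next) (families-cover 1≤m) ε 11≤
  go (m , 1≤m , m-ok , inj₁ refl) =
    probNotPS-bound sp (smallFamily m ∷ []) (smallFamily-cheap {p} {D n} {m} m-ok ∷ [])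
      (λ S schur → smallFamily m , here refl , smallFamily-covers 1≤m S schur) ε
      (ℚ.≤-trans (ι-mono-≤ (s≤s z≤n)) 11≤)

-- The hypothesis is the ninth power of p ≤ n^(-1/9) ω^(-1). As D(n) ≥ 1, it suffices that D^17 ≤
-- D^100 = ω ≤ ω^9.
hypothesis⇒sparse : ∀ {p n} → 0ℚ ≤ p → p ≤ 1ℚ → 1 ℕ.≤ n →
  (p ^ℚ 9) * ℕ→ℚ n * (ℕ→ℚ (ω n) ^ℚ 9) ≤ 1ℚ → Sparse p n (D n)
hypothesis⇒sparse {p} {n} 0≤p p≤1 1≤n hyp = sparse 0≤p p≤1 1≤n 1≤D (begin
  ι (n ℕ.* D n ^ 17) * p ^ℚ 9         ≡⟨ cong (_* p ^ℚ 9) (ι-* n (D n ^ 17)) ⟩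
  ι n * ι (D n ^ 17) * p ^ℚ 9         ≡⟨ solve 3 (λ n d x → n :* d :* x := x :* n :* d) refl (ι n) (ι (D n ^ 17)) (p ^ℚ 9) ⟩
  p ^ℚ 9 * ι n * ι (D n ^ 17)         ≤⟨ ℚ.*-monoˡ-≤-nonNeg (p ^ℚ 9 * ι n) {{ℚ.nonNegative (*-nonNeg (^ℚ≥0 0≤p 9) (ι≥0 n))}} D^17≤ ⟩
  p ^ℚ 9 * ι n * ι (ω n) ^ℚ 9         ≤⟨ subst₂ (λ x y → p ^ℚ 9 * x * y ^ℚ 9 ≤ 1ℚ) (sym (ι≡ n)) (sym (ι≡ (ω n))) hyp ⟩
  1ℚ                                  ∎)
  where
  open ℚ.≤-Reasoning
  open +-*-Solver
  1≤D : 1 ℕ.≤ D n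
  1≤D = d≤D 1≤n
  instance _ = ℕ.>-nonZero 1≤D
  1≤ω : 1ℚ ≤ ι (ω n)
  1≤ω = subst (_≤ ι (ω n)) ι-1 (ι-mono-≤ (ℕ.m^n>0 (D n) 100))
  D^17≤ : ι (D n ^ 17) ≤ ι (ω n) ^ℚ 9
  D^17≤ = ℚ.≤-trans (ι-mono-≤ (ℕ.^-monoʳ-≤ (D n) (ℕ.m≤m+n 17 83)))
                    (x≤x*y (ι≥0 (ω n)) (1≤^ℚ 1≤ω 8))

theorem2p1 : (p : ℕ → ℚ) →
    (∀ n → 0ℚ ≤ p n) → (∀ n → p n ≤ 1ℚ) →
    (∀ n → (p n ^ℚ 9) * ℕ→ℚ n * (ℕ→ℚ (ω n) ^ℚ 9) ≤ 1ℚ) →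
    (ε : ℚ) → 0ℚ < ε →
    ∃ λ N → ∀ n → n ≥ N → 1ℚ - ε ≤ probNotPS (p n) n
-- With `b ε ≥ 1`, this threshold gives D(n) ≥ 11 b and thus ε D(n) ≥ 11, one unit for each family.
theorem2p1 p 0≤p p≤1 hyp ε 0<ε = 2 ^ (11 ℕ.* b) , λ n n≥N →
  sparse⇒probNotPS (hypothesis⇒sparse (0≤p n) (p≤1 n) (ℕ.≤-trans (ℕ.m^n>0 2 (11 ℕ.* b)) n≥N) (hyp n)) ε
    (begin
      ι 11                      ≤⟨ x≤x*y (ι≥0 11) 1≤bε ⟩
      ι 11 * (ι b * ε)          ≡⟨ solve 3 (λ x y e → x :* (y :* e) := e :* (x :* y)) refl (ι 11) (ι b) ε ⟩
      ε * (ι 11 * ι b)          ≡⟨ cong (ε *_) (ι-* 11 b) ⟨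
      ε * ι (11 ℕ.* b)          ≤⟨ ℚ.*-monoˡ-≤-nonNeg ε {{ℚ.nonNegative (ℚ.<⇒≤ 0<ε)}} (ι-mono-≤ (D-unbounded (11 ℕ.* b) n≥N)) ⟩
      ε * ι (D n)               ∎)
  where
  open ℚ.≤-Reasoning
  open +-*-Solver
  b    = proj₁ (ι-archimedean 0<ε)
  1≤bε = proj₂ (ι-archimedean 0<ε)
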